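{- Let $k\ge 2$ be an integer. There exists $\ell_0=\ell_0(k)$ such that for every $\ell\ge \ell_0$ the following holds. Let $G$ be an $\ell$-partite graph with (nonempty, finite) parts $V_1,V_2,\ldots,V_\ell$ such that $$d(V_i,V_j)=\frac{\|G[V_i\cup V_j]\|}{|V_i||V_j|}\ge \frac{k-2}{k-1}\quad\text{for all } i\ne j.$$ Then $G$ contains a complete graph $K^k$, or $G$ is isomorphic to a graph in $\mathcal{G}^k_\ell$.
   Context: All graphs are simple and finite; $\|H\|$ denotes the number of edges of $H$, and $G[V_i\cup V_j]$ is the subgraph induced on $V_i\cup V_j$ (which, as $G$ is $\ell$-partite with parts $V_i$, has only edges between $V_i$ and $V_j$). For $\ell\ge (k-1)!$, let $\pi_1,\ldots,\pi_{(k-1)!}$ be an enumeration of all permutations of $\{1,\ldots,k-1\}$. A graph is in $\bar{\mathcal{G}}^k_\ell$ if it has vertex set $\{(i,s,t):1\le i\le \ell,\ 1\le s\le k-1,\ 1\le t\le n_i^s\}$ and edge set $\{(i,s,t)(i',s',t'): i\ne i',\ s\ne s'\}$, where the nonnegative integers $n_i^s$ satisfy: $n_i^{\pi_i(1)}\ge n_i^{\pi_i(2)}\ge\cdots\ge n_i^{\pi_i(k-1)}$ for $1\le i\le (k-1)!$; $n_i^1=n_i^2=\cdots=n_i^{k-1}$ for $(k-1)!<i\le \ell$; and $\sum_s n_i^s>0$ for every $1\le i\le \ell$. Such a graph is $\ell$-partite with parts $\{(i,s,t): s,t\}$, $1\le i\le\ell$. The class $\mathcal{G}^k_\ell$ consists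 of all graphs obtained from a graph in $\bar{\mathcal{G}}^k_\ell$ by deleting some of the edges in $\{(i,s,t)(i',s',t'): s\ne s',\ 1\le i<i'\le (k-1)!\}$. -}

module Defs where

open import Data.Nat using (ℕ; zero; suc; _+_; _*_; _∸_; _≤_; _<_; _!)
open import Data.Nat.ListAction using (sum)
open import Data.Bool using (Bool; true; false; if_then_else_)
open import Data.Fin using (Fin; toℕ; fromℕ<)
import Data.Fin as F
open import Data.List using (List; map; allFin)
open import Data.Product using (Σ; ∃; ∃-syntax; _×_; _,_; proj₁; proj₂)
open import Data.Fin.Permutation using (Permutation′; _⟨$⟩ʳ_)
open import Function.Bundles using (_↔_; Inverse)
open import Relation.Binary.PropositionalEquality using (_≡_; _≢_)
open import Relation.Nullary using (¬_)

count : ∀ {n} → (Fin n → Bool) → ℕ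
count {n} f = sum (map (λ t → if f t then 1 else 0) (allFin n))

record PartiteGraph (ℓ : ℕ) : Set where
  field
    size     : Fin ℓ → ℕ
    nonempty : ∀ i → 0 < size i
  Vertex : Set
  Vertex = Σ (Fin ℓ) λ i → Fin (size i)
  field
    adj      : Vertex → Vertex → Bool
    symm     : ∀ u v → adj u v ≡ adj v u
    partite  : ∀ u v → proj₁ u ≡ proj₁ v → adj u v ≡ false

  edgesBetween : Fin ℓ → Fin ℓ → ℕ
  edgesBetween i j =
    sum (map (λ a → count (λ b → adj (i , a) (j , b))) (allFin (size i)))

open PartiteGraph public

-- d(V_i,V_j) ≥ (k-2)/(k-1) for all i ≠ j, cross-multiplied over ℕ
-- (denominators |V_i||V_j| > 0 and k-1 > 0).
DensityCondition : ∀ {ℓ} → ℕ → PartiteGraph ℓ → Set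
DensityCondition {ℓ} k G =
  ∀ (i j : Fin ℓ) → i ≢ j →
    (k ∸ 2) * (size G i * size G j) ≤ (k ∸ 1) * edgesBetween G i j

ContainsK : ∀ {ℓ} → ℕ → PartiteGraph ℓ → Set
ContainsK {ℓ} k G =
  Σ (Fin k → Vertex G) λ f → ((∀ (a b : Fin k) → f a ≡ f b → a ≡ b) ×
          (∀ (a b : Fin k) → a ≢ b → adj G (f a) (f b) ≡ true))

PermEq : ∀ {m} → Permutation′ m → Permutation′ m → Set
PermEq σ τ = ∀ x → σ ⟨$⟩ʳ x ≡ τ ⟨$⟩ʳ x

record PermEnumeration (m : ℕ) : Set where
  field
    π          : Fin (m !) → Permutation′ m
    surjective : ∀ (σ : Permutation′ m) → ∃[ i ] PermEq (π i) σ
    injective  : ∀ i j → PermEq (π i) (π j) → i ≡ j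

open PermEnumeration public

-- "i ≤ (k-1)!" in 1-based indexing, i.e. toℕ i < (k-1)! in 0-based.
Low : ∀ {ℓ} → ℕ → Fin ℓ → Set
Low k i = toℕ i < (k ∸ 1) !

record ClassParams (k ℓ : ℕ) (E : PermEnumeration (k ∸ 1)) : Set where
  field
    n        : Fin ℓ → Fin (k ∸ 1) → ℕ
    ordered  : ∀ i (lo : Low k i) (a b : Fin (k ∸ 1)) → toℕ a ≤ toℕ b →
               n i (π E (fromℕ< lo) ⟨$⟩ʳ b) ≤ n i (π E (fromℕ< lo) ⟨$⟩ʳ a)
    balanced : ∀ i → ¬ Low k i → ∀ s s' → n i s ≡ n i s'
    positive : ∀ i → 0 < sum (map (n i) (allFin (k ∸ 1)))

  CVertex : Set
  CVertex = Σ (Fin ℓ) λ i → Σ (Fin (k ∸ 1)) λ s → Fin (n i s)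

open ClassParams public

BarEdge : ∀ {k ℓ E} (P : ClassParams k ℓ E) → CVertex P → CVertex P → Set
BarEdge P (i , s , _) (i' , s' , _) = i ≢ i' × s ≢ s'

Deletable : ∀ {k ℓ E} (P : ClassParams k ℓ E) → CVertex P → CVertex P → Set
Deletable {k} P (i , s , _) (i' , s' , _) =
  i ≢ i' × s ≢ s' × Low k i × Low k i'

record ClassGraph (k ℓ : ℕ) (E : PermEnumeration (k ∸ 1)) : Set where
  field
    params : ClassParams k ℓ E
    hadj   : CVertex params → CVertex params → Bool
    hsymm  : ∀ u v → hadj u v ≡ hadj v u
    sub    : ∀ u v → hadj u v ≡ true → BarEdge params u v
    kept   : ∀ u v → BarEdge params u v → ¬ Deletable params u v →
             hadj u v ≡ true

open ClassGraph public

IsoToClass : ∀ {k ℓ E} → PartiteGraph ℓ → ClassGraph k ℓ E → Set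
IsoToClass G H =
  Σ (Vertex G ↔ CVertex (params H)) λ φ →
    ∀ u v → adj G u v ≡ hadj H (Inverse.to φ u) (Inverse.to φ v)

InClass : ∀ k ℓ → PermEnumeration (k ∸ 1) → PartiteGraph ℓ → Set
InClass k ℓ E G = ∃[ H ] IsoToClass {k} {ℓ} {E} G H

{-# OPTIONS --safe #-}
-- Give every vertex the weight N / |V_i| of its part, so that all parts have weight N, and
-- let r = k - 1.  If G has no K^k, Füredi's stability argument gives an r-colouring c whose
-- monochromatic edges have total weight at most ℓN², which is negligible against (ℓN)².
-- Hence almost all edges between different colours are present, and each vertex v can be
-- recoloured by a colour b(v) that is rare in its neighbourhood.  By pigeonhole many parts
-- J order the weights of their b-classes in the same way; by Chebyshev's sum inequality the
-- density condition then says that inside J there are at most as many missing edges as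
-- monochromatic ones.  But each end of a monochromatic edge has few monochromatic edges and
-- one of the ends misses many edges, so in J there are none of either, and the parts of J
-- are exactly balanced.  An averaging argument against J colours every other vertex, and
-- the colouring obtained is proper.  Finally, again by Chebyshev, two unbalanced parts
-- cannot have the same ordering of their class sizes, so that there are at most (k-1)! of
-- them and G lies in the class.
module Submission where

open import Defs
open import Data.Bool using (Bool; true; false; if_then_else_; not; _∧_) renaming (T to IsTrue)
import Data.Bool.Properties as Bool
open import Data.Empty using (⊥-elim)
open import Data.Fin using (Fin; zero; suc; toℕ; punchIn; fromℕ; fromℕ<; inject≤)
open import Data.Fin.Permutation
  using (Permutation′; _⟨$⟩ʳ_; _⟨$⟩ˡ_; _∘ₚ_; lift₀; transpose; inverseˡ; inverseʳ)
import Data.Fin.Permutation as Perm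
open import Data.Fin.Properties
  using (_≟_; suc-injective; any?; all?; punchIn-injective; punchInᵢ≢i; toℕ-inject≤;
         toℕ-injective; toℕ-fromℕ<; toℕ<n; ≤fromℕ; inject≤-injective)
open import Data.List
  using (List; []; _∷_; _++_; map; allFin; length; filter; lookup; concatMap; cartesianProduct)
open import Data.List.Membership.Propositional using (_∈_; find; lose)
open import Data.List.Membership.Propositional.Properties
  using (∈-allFin; ∈-concatMap⁺; ∈-map⁺; ∈-cartesianProduct⁺; ∈-filter⁺; ∈-filter⁻; ∈-lookup)
open import Data.List.Properties using (map-tabulate; map-∘; map-++)
import Data.List.Relation.Unary.All as All
open import Data.List.Relation.Unary.AllPairs using ([]; _∷_)
open import Data.List.Relation.Unary.Any using (here; there)
import Data.List.Relation.Unary.Any as Any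
open import Data.List.Relation.Unary.Any.Properties using (lookup-index)
open import Data.List.Relation.Unary.Unique.Propositional using (Unique)
import Data.List.Relation.Unary.Unique.Propositional.Properties as Unique
open import Data.Nat
  using (ℕ; zero; suc; _+_; _*_; _∸_; _^_; _≤_; _<_; _≤ᵇ_; z≤n; s≤s; ∣_-_∣; _≤?_; _<?_; _!; >-nonZero)
open import Data.Nat.ListAction using (sum)
open import Data.Nat.ListAction.Properties using (sum-++)
open import Data.Nat.Properties hiding (suc-injective) renaming (_≟_ to _≟ℕ_)
open import Data.Nat.Tactic.RingSolver using (solve-∀)
open import Data.Product using (Σ; ∃-syntax; _×_; _,_; proj₁; proj₂)
open import Data.Product.Function.Dependent.Propositional using () renaming (cong to Σ-cong)
open import Data.Sum using (_⊎_; inj₁; inj₂)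
open import Data.Unit using (⊤; tt)
open import Function using (_∘_)
open import Function.Bundles using (_↔_; Inverse; mk↔ₛ′)
open import Function.Construct.Symmetry using (↔-sym)
open import Relation.Binary.PropositionalEquality
open import Relation.Nullary using (¬_; Dec; yes; no; does; contradiction)
open import Relation.Nullary.Decidable using (_×-dec_; ¬?)
open import Relation.Unary using (Decidable)

-- With equal part weights the density condition becomes one bound, `pair nad` at most N²/r, and any
-- colouring satisfies nad + mono = miss + same on each pair of parts, where `same` is the sum of
-- products of class weights. The whole proof reads this identity in both directions. If two parts
-- order their classes alike, Chebyshev gives same at least N²/r, hence miss at most mono. For
-- different orders `same` can be smaller, which is why the argument retreats to J and why
-- exceptional parts have to be allowed. The opposing bound, 2 mono at most miss on J, needs control
-- at every vertex, whereas stability controls only totals. This is the purpose of b: v has weight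
-- at most ℓN/(64rQ) of neighbours in the c-class b(v), which is still small when measured against
-- J, a 1/Q share of all parts. There is no circularity, since Q = 2^(r²) bounds the outcomes of the
-- r² comparisons between class weights and depends on k only. The error term ℓN² comes from the
-- pairs inside a single part, on which the density condition is silent.

private variable
  A B : Set

-- Certificates for linear inequalities: a ≤ b is a nonnegative combination of the
-- hypotheses and k is the slack, so that the equation is a semiring identity.
linear : ∀ {a b x y} k → a ≤ b → x + b + k ≡ y + a → x ≤ y
linear {a} {b} {x} {y} k a≤b eq = +-cancelʳ-≤ a x y (begin
  x + a      ≤⟨ +-monoʳ-≤ x a≤b ⟩
  x + b      ≤⟨ m≤m+n (x + b) k ⟩
  x + b + k  ≡⟨ eq ⟩
  y + a      ∎)
  where open ≤-Reasoning

-- Finite sums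

∑ : List A → (A → ℕ) → ℕ
∑ xs f = sum (map f xs)

∑-cong : ∀ (xs : List A) {f g} → (∀ x → f x ≡ g x) → ∑ xs f ≡ ∑ xs g
∑-cong []       e = refl
∑-cong (x ∷ xs) e = cong₂ _+_ (e x) (∑-cong xs e)

∑-mono : ∀ (xs : List A) {f g} → (∀ x → f x ≤ g x) → ∑ xs f ≤ ∑ xs g
∑-mono []       e = z≤n
∑-mono (x ∷ xs) e = +-mono-≤ (e x) (∑-mono xs e)

∑-distrib-+ : ∀ (xs : List A) f g → ∑ xs (λ x → f x + g x) ≡ ∑ xs f + ∑ xs g
∑-distrib-+ []       f g = refl
∑-distrib-+ (x ∷ xs) f g = trans (cong (f x + g x +_) (∑-distrib-+ xs f g)) (shuffle (f x) (g x) _ _)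
  where
  shuffle : ∀ a b c d → a + b + (c + d) ≡ a + c + (b + d)
  shuffle = solve-∀

∑-distrib-*ˡ : ∀ (xs : List A) k f → ∑ xs (λ x → k * f x) ≡ k * ∑ xs f
∑-distrib-*ˡ []       k f = sym (*-zeroʳ k)
∑-distrib-*ˡ (x ∷ xs) k f =
  trans (cong (k * f x +_) (∑-distrib-*ˡ xs k f)) (sym (*-distribˡ-+ k (f x) _))

∑-zero : ∀ (xs : List A) → ∑ xs (λ _ → 0) ≡ 0
∑-zero []       = refl
∑-zero (x ∷ xs) = ∑-zero xs

∑-swap : ∀ (xs : List A) (ys : List B) (f : A → B → ℕ) →
         ∑ xs (λ x → ∑ ys (f x)) ≡ ∑ ys (λ y → ∑ xs (λ x → f x y))
∑-swap []       ys f = sym (∑-zero ys)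
∑-swap (x ∷ xs) ys f =
  trans (cong (∑ ys (f x) +_) (∑-swap xs ys f))
        (sym (∑-distrib-+ ys (f x) (λ y → ∑ xs (λ x → f x y))))

-- The averaging principle behind the choices of vertices: a strict inequality between totals yields
-- one witness.
∑-< : ∀ (xs : List A) {f g} → ∑ xs f < ∑ xs g → ∃[ x ] f x < g x
∑-< (x ∷ xs) {f} {g} lt with f x <? g x
... | yes p = x , p
... | no ¬p = ∑-< xs (+-cancelˡ-< (f x) _ _ (<-≤-trans lt (+-monoˡ-≤ (∑ xs g) (≮⇒≥ ¬p))))

∑-pos : ∀ (xs : List A) {f} → 0 < ∑ xs f → ∃[ x ] 0 < f x
∑-pos xs {f} lt = ∑-< xs (subst (_< ∑ xs f) (sym (∑-zero xs)) lt)

∑-∈ : ∀ {xs : List A} f {x} → x ∈ xs → f x ≤ ∑ xs f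
∑-∈ f (here refl)          = m≤m+n _ _
∑-∈ f (there {x = y} x∈xs) = ≤-trans (∑-∈ f x∈xs) (m≤n+m _ (f y))

-- The equality case of `∑-mono`: if the totals leave no room, no single term has any. It later
-- turns tight averages (Chebyshev, density) into pointwise equalities.
∑-tight : ∀ {xs : List A} {f g} → (∀ x → g x ≤ f x) → ∑ xs f ≤ ∑ xs g →
          ∀ {x} → x ∈ xs → f x ≤ g x
∑-tight {xs = y ∷ xs} {f} {g} g≤f le (here refl) =
  +-cancelʳ-≤ (∑ xs g) _ _ (≤-trans (+-monoʳ-≤ (f y) (∑-mono xs g≤f)) le)
∑-tight {xs = y ∷ xs} {f} {g} g≤f le (there x∈xs) =
  ∑-tight g≤f (+-cancelˡ-≤ (g y) _ _ (≤-trans (+-monoˡ-≤ (∑ xs f) (g≤f y)) le)) x∈xs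

∑-++ : ∀ (xs ys : List A) f → ∑ (xs ++ ys) f ≡ ∑ xs f + ∑ ys f
∑-++ xs ys f = trans (cong sum (map-++ f xs ys)) (sum-++ (map f xs) (map f ys))

∑-map : ∀ (g : A → B) (xs : List A) f → ∑ (map g xs) f ≡ ∑ xs (f ∘ g)
∑-map g xs f = cong sum (sym (map-∘ xs))

∑-concatMap : ∀ (g : A → List B) xs f → ∑ (concatMap g xs) f ≡ ∑ xs (λ x → ∑ (g x) f)
∑-concatMap g []       f = refl
∑-concatMap g (x ∷ xs) f =
  trans (∑-++ (g x) (concatMap g xs) f) (cong (∑ (g x) f +_) (∑-concatMap g xs f))

∑-suc : ∀ n (f : Fin (suc n) → ℕ) → ∑ (allFin (suc n)) f ≡ f zero + ∑ (allFin n) (f ∘ suc)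
∑-suc n f = cong (f zero +_) (cong sum (trans (map-tabulate suc f) (sym (map-tabulate (λ i → i) (f ∘ suc)))))

∑-const : ∀ n k → ∑ (allFin n) (λ _ → k) ≡ n * k
∑-const zero    k = refl
∑-const (suc n) k = trans (∑-suc n _) (cong (k +_) (∑-const n k))

⟦_⟧ : Bool → ℕ
⟦ b ⟧ = if b then 1 else 0

⟦⟧≤1 : ∀ b → ⟦ b ⟧ ≤ 1
⟦⟧≤1 true  = ≤-refl
⟦⟧≤1 false = z≤n

δ : ∀ {n} → Fin n → Fin n → ℕ
δ i j = ⟦ does (i ≟ j) ⟧

δ̅ : ∀ {n} → Fin n → Fin n → ℕ
δ̅ i j = ⟦ not (does (i ≟ j)) ⟧

δ-refl : ∀ {n} (i : Fin n) → δ i i ≡ 1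
δ-refl i with i ≟ i
... | yes _ = refl
... | no ¬p = contradiction refl ¬p

δ-sym : ∀ {n} (i j : Fin n) → δ i j ≡ δ j i
δ-sym i j with i ≟ j | j ≟ i
... | yes _ | yes _ = refl
... | no _  | no _  = refl
... | yes p | no ¬q = contradiction (sym p) ¬q
... | no ¬p | yes q = contradiction (sym q) ¬p

δ-suc : ∀ {n} (i j : Fin n) → δ (suc i) (suc j) ≡ δ i j
δ-suc i j with i ≟ j
... | yes _ = refl
... | no _  = refl

δ-≢ : ∀ {n} {i j : Fin n} → i ≢ j → δ i j ≡ 0
δ-≢ {i = i} {j} i≢j with i ≟ j
... | yes p = contradiction p i≢j
... | no _  = refl

δ̅-≢ : ∀ {n} {i j : Fin n} → i ≢ j → δ̅ i j ≡ 1
δ̅-≢ {i = i} {j} i≢j with i ≟ j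
... | yes p = contradiction p i≢j
... | no _  = refl

δ+δ̅ : ∀ {n} (i j : Fin n) → δ i j + δ̅ i j ≡ 1
δ+δ̅ i j with i ≟ j
... | yes _ = refl
... | no _  = refl

δ̅-refl : ∀ {n} (i : Fin n) → δ̅ i i ≡ 0
δ̅-refl i with i ≟ i
... | yes _ = refl
... | no ¬p = contradiction refl ¬p

∑-δ : ∀ n (f : Fin n → ℕ) j → ∑ (allFin n) (λ i → δ j i * f i) ≡ f j
∑-δ (suc n) f zero = begin
  ∑ (allFin (suc n)) (λ i → δ zero i * f i)  ≡⟨ ∑-suc n _ ⟩
  f zero + 0 + ∑ (allFin n) (λ _ → 0)        ≡⟨ cong₂ _+_ (+-identityʳ (f zero)) (∑-zero (allFin n)) ⟩
  f zero + 0                                 ≡⟨ +-identityʳ (f zero) ⟩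
  f zero                                     ∎
  where open ≡-Reasoning
∑-δ (suc n) f (suc j) = begin
  ∑ (allFin (suc n)) (λ i → δ (suc j) i * f i)     ≡⟨ ∑-suc n (λ i → δ (suc j) i * f i) ⟩
  ∑ (allFin n) (λ i → δ (suc j) (suc i) * f (suc i)) ≡⟨ ∑-cong (allFin n) (λ i → cong (_* f (suc i)) (δ-suc j i)) ⟩
  ∑ (allFin n) (λ i → δ j i * f (suc i))           ≡⟨ ∑-δ n (f ∘ suc) j ⟩
  f (suc j)                                        ∎
  where open ≡-Reasoning

-- Weighted sums over one and over two variables

mass : List A → (A → ℕ) → (A → ℕ) → ℕ
mass xs X φ = ∑ xs (λ x → X x * φ x)

module _ (xs : List A) where

  mass-cong : ∀ X {φ ψ} → (∀ x → φ x ≡ ψ x) → mass xs X φ ≡ mass xs X ψ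
  mass-cong X e = ∑-cong xs (λ x → cong (X x *_) (e x))

  mass-mono : ∀ X {φ ψ} → (∀ x → φ x ≤ ψ x) → mass xs X φ ≤ mass xs X ψ
  mass-mono X e = ∑-mono xs (λ x → *-monoʳ-≤ (X x) (e x))

  mass-monoˡ : ∀ {X Y} φ → (∀ x → X x ≤ Y x) → mass xs X φ ≤ mass xs Y φ
  mass-monoˡ φ e = ∑-mono xs (λ x → *-monoˡ-≤ (φ x) (e x))

  mass-+ : ∀ X φ ψ → mass xs X (λ x → φ x + ψ x) ≡ mass xs X φ + mass xs X ψ
  mass-+ X φ ψ = trans (∑-cong xs (λ x → *-distribˡ-+ (X x) (φ x) (ψ x))) (∑-distrib-+ xs _ _)

  mass-*ˡ : ∀ X k φ → mass xs X (λ x → k * φ x) ≡ k * mass xs X φ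
  mass-*ˡ X k φ = trans (∑-cong xs (λ x → shuffle (X x) k (φ x))) (∑-distrib-*ˡ xs k _)
    where
    shuffle : ∀ a b c → a * (b * c) ≡ b * (a * c)
    shuffle = solve-∀

  mass-*ʳ : ∀ X k φ → mass xs X (λ x → φ x * k) ≡ mass xs X φ * k
  mass-*ʳ X k φ = trans (mass-cong X (λ x → *-comm (φ x) k)) (trans (mass-*ˡ X k φ) (*-comm k _))

  mass-≤+ : ∀ X {φ} ψ χ → (∀ x → φ x ≤ ψ x + χ x) → mass xs X φ ≤ mass xs X ψ + mass xs X χ
  mass-≤+ X ψ χ e = ≤-trans (mass-mono X e) (≤-reflexive (mass-+ X ψ χ))

  mass-≤++ : ∀ X {φ} ψ χ ω → (∀ x → φ x ≤ ψ x + χ x + ω x) →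
             mass xs X φ ≤ mass xs X ψ + mass xs X χ + mass xs X ω
  mass-≤++ X ψ χ ω e =
    ≤-trans (mass-≤+ X (λ x → ψ x + χ x) ω e) (+-monoˡ-≤ (mass xs X ω) (≤-reflexive (mass-+ X ψ χ)))

mass-swap : ∀ (xs : List A) (ys : List B) X Y (K : A → B → ℕ) →
            mass xs X (λ x → mass ys Y (K x)) ≡ mass ys Y (λ y → mass xs X (λ x → K x y))
mass-swap xs ys X Y K = begin
  ∑ xs (λ x → X x * ∑ ys (λ y → Y y * K x y))    ≡⟨ ∑-cong xs (λ x → sym (∑-distrib-*ˡ ys (X x) _)) ⟩
  ∑ xs (λ x → ∑ ys (λ y → X x * (Y y * K x y)))  ≡⟨ ∑-swap xs ys (λ x y → X x * (Y y * K x y)) ⟩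
  ∑ ys (λ y → ∑ xs (λ x → X x * (Y y * K x y)))  ≡⟨ ∑-cong ys (λ y → ∑-cong xs (λ x → shuffle (X x) (Y y) (K x y))) ⟩
  ∑ ys (λ y → ∑ xs (λ x → Y y * (X x * K x y)))  ≡⟨ ∑-cong ys (λ y → ∑-distrib-*ˡ xs (Y y) _) ⟩
  ∑ ys (λ y → Y y * ∑ xs (λ x → X x * K x y))    ∎
  where
  open ≡-Reasoning
  shuffle : ∀ a b c → a * (b * c) ≡ b * (a * c)
  shuffle = solve-∀

bimass : List A → (A → ℕ) → (A → ℕ) → (A → A → ℕ) → ℕ
bimass xs X Y K = mass xs X (λ x → mass xs Y (K x))

module _ (xs : List A) (X Y : A → ℕ) where

  bimass-cong : ∀ {K L} → (∀ x y → K x y ≡ L x y) → bimass xs X Y K ≡ bimass xs X Y L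
  bimass-cong e = mass-cong xs X (λ x → mass-cong xs Y (e x))

  bimass-mono : ∀ {K L} → (∀ x y → K x y ≤ L x y) → bimass xs X Y K ≤ bimass xs X Y L
  bimass-mono e = mass-mono xs X (λ x → mass-mono xs Y (e x))

  bimass-+ : ∀ K L → bimass xs X Y (λ x y → K x y + L x y) ≡ bimass xs X Y K + bimass xs X Y L
  bimass-+ K L = trans (mass-cong xs X (λ x → mass-+ xs Y (K x) (L x))) (mass-+ xs X _ _)

  bimass-*ˡ : ∀ k K → bimass xs X Y (λ x y → k * K x y) ≡ k * bimass xs X Y K
  bimass-*ˡ k K = trans (mass-cong xs X (λ x → mass-*ˡ xs Y k (K x))) (mass-*ˡ xs X k _)

  bimass-× : ∀ φ ψ → bimass xs X Y (λ x y → φ x * ψ y) ≡ mass xs X φ * mass xs Y ψ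
  bimass-× φ ψ = trans (mass-cong xs X (λ x → mass-*ˡ xs Y (φ x) ψ)) (mass-*ʳ xs X (mass xs Y ψ) φ)

bimass-monoˡ : ∀ (xs : List A) {X X′ Y Y′} K → (∀ x → X x ≤ X′ x) → (∀ x → Y x ≤ Y′ x) →
               bimass xs X Y K ≤ bimass xs X′ Y′ K
bimass-monoˡ xs {X′ = X′} K X≤ Y≤ =
  ≤-trans (mass-monoˡ xs _ X≤) (mass-mono xs X′ (λ x → mass-monoˡ xs (K x) Y≤))

-- Cliques inside a predicate

module Cliques {A : Set} (adj : A → A → Bool) where

  record Clique (P : A → Set) (m : ℕ) : Set where
    constructor clique
    field
      vertex   : Fin m → A
      inside   : ∀ a → P (vertex a)
      adjacent : ∀ a b → a ≢ b → adj (vertex a) (vertex b) ≡ true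

  module _ (adj-sym : ∀ u v → adj u v ≡ adj v u) where

    extend : ∀ {P : A → Set} {m} x → P x → (K : Clique P m) →
             (∀ a → adj x (Clique.vertex K a) ≡ true) → Clique P (suc m)
    extend {P} {m} x px (clique f in-f adj-f) adj-x = clique g in-g adj-g
      where
      g : Fin (suc m) → A
      g zero    = x
      g (suc a) = f a
      in-g : ∀ a → P (g a)
      in-g zero    = px
      in-g (suc a) = in-f a
      adj-g : ∀ a b → a ≢ b → adj (g a) (g b) ≡ true
      adj-g zero    zero    ne = contradiction refl ne
      adj-g zero    (suc b) ne = adj-x b
      adj-g (suc a) zero    ne = trans (adj-sym _ _) (adj-x a)
      adj-g (suc a) (suc b) ne = adj-f a b (ne ∘ cong suc)

    restrict : ∀ {P Q : A → Set} {m} → (∀ {x} → P x → Q x) → Clique P m → Clique Q m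
    restrict imp (clique f in-f adj-f) = clique f (imp ∘ in-f) adj-f

-- Squares, positivity and the variance identity

square-difference : ∀ a b → a * a + b * b ≡ 2 * (a * b) + ∣ a - b ∣ * ∣ a - b ∣
square-difference zero    b       = refl
square-difference (suc a) zero    = base (suc a)
  where
  base : ∀ a → a * a + 0 ≡ 2 * (a * 0) + a * a
  base = solve-∀
square-difference (suc a) (suc b) =
  trans (lhs a b) (trans (cong (_+ (2 * a + 2 * b + 2)) (square-difference a b)) (rhs a b (∣ a - b ∣ * ∣ a - b ∣)))
  where
  lhs : ∀ a b → suc a * suc a + suc b * suc b ≡ a * a + b * b + (2 * a + 2 * b + 2)
  lhs = solve-∀
  rhs : ∀ a b d → 2 * (a * b) + d + (2 * a + 2 * b + 2) ≡ 2 * (suc a * suc b) + d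
  rhs = solve-∀

am-gm : ∀ a b → 2 * (a * b) ≤ a * a + b * b
am-gm a b = subst (2 * (a * b) ≤_) (sym (square-difference a b)) (m≤m+n _ _)

0<*ˡ : ∀ {m n} → 0 < m * n → 0 < m
0<*ˡ {suc m} lt = s≤s z≤n

0<*ʳ : ∀ {m n} → 0 < m * n → 0 < n
0<*ʳ {m} {n} lt = 0<*ˡ (subst (0 <_) (*-comm m n) lt)

*-pos : ∀ {m n} → 0 < m → 0 < n → 0 < m * n
*-pos = *-mono-≤

⟦⟧-true : ∀ {b} → 0 < ⟦ b ⟧ → b ≡ true
⟦⟧-true {true} _ = refl

-- The variance identity cleared of denominators: the last sum is r² times the squared deviation
-- from the mean S / r. Dropping it gives Cauchy-Schwarz; keeping it bounds each single class from
-- below in `class-large`.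
∑-variance : ∀ r (n : Fin r → ℕ) → let S = ∑ (allFin r) n in
  r * r * ∑ (allFin r) (λ s → n s * n s) ≡
  r * (S * S) + ∑ (allFin r) (λ s → ∣ r * n s - S ∣ * ∣ r * n s - S ∣)
∑-variance r n = +-cancelʳ-≡ (r * (S * S)) _ _ (begin
  r * r * ∑ F (λ s → n s * n s) + r * (S * S)
    ≡⟨ cong₂ _+_ (sym (∑-distrib-*ˡ F (r * r) _)) (sym (∑-const r (S * S))) ⟩
  ∑ F (λ s → r * r * (n s * n s)) + ∑ F (λ _ → S * S)
    ≡⟨ sym (∑-distrib-+ F (λ s → r * r * (n s * n s)) (λ _ → S * S)) ⟩
  ∑ F (λ s → r * r * (n s * n s) + S * S)
    ≡⟨ ∑-cong F pointwise ⟩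
  ∑ F (λ s → 2 * r * S * n s + D s)
    ≡⟨ ∑-distrib-+ F (λ s → 2 * r * S * n s) D ⟩
  ∑ F (λ s → 2 * r * S * n s) + ∑ F D
    ≡⟨ cong (_+ ∑ F D) (∑-distrib-*ˡ F (2 * r * S) n) ⟩
  2 * r * S * S + ∑ F D
    ≡⟨ shuffle r S (∑ F D) ⟩
  r * (S * S) + ∑ F D + r * (S * S) ∎)
  where
  open ≡-Reasoning
  F = allFin r
  S = ∑ F n
  D : Fin r → ℕ
  D s = ∣ r * n s - S ∣ * ∣ r * n s - S ∣
  shuffle : ∀ r S d → 2 * r * S * S + d ≡ r * (S * S) + d + r * (S * S)
  shuffle = solve-∀
  lhs : ∀ r n S → r * r * (n * n) + S * S ≡ r * n * (r * n) + S * S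
  lhs = solve-∀
  rhs : ∀ r n S d → 2 * (r * n * S) + d ≡ 2 * r * S * n + d
  rhs = solve-∀
  pointwise : ∀ s → r * r * (n s * n s) + S * S ≡ 2 * r * S * n s + D s
  pointwise s = trans (lhs r (n s) S) (trans (square-difference (r * n s) S) (rhs r (n s) S (D s)))

-- Chebyshev's sum inequality

module _ {r} (a b : Fin r → ℕ) where

  SameOrder : Set
  SameOrder = ∀ s t → (a s ≤ a t × b s ≤ b t) ⊎ (a t ≤ a s × b t ≤ b s)

  private
    F = allFin r
    S = ∑ F (λ s → a s * b s)

  rearrangement : ∀ {m m′ n n′} → m ≤ m′ → n ≤ n′ → m * n′ + m′ * n ≤ m * n + m′ * n′
  rearrangement {m} {m′} {n} {n′} m≤ n≤ =
    subst₂ (λ x y → m * y + x * n ≤ m * n + x * y) (m+[n∸m]≡n m≤) (m+[n∸m]≡n n≤)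
      (linear {0} {0} ((m′ ∸ m) * (n′ ∸ n)) z≤n (shuffle m (m′ ∸ m) n (n′ ∸ n)))
    where
    shuffle : ∀ m k n l → m * (n + l) + (m + k) * n + 0 + k * l ≡ m * n + (m + k) * (n + l) + 0
    shuffle = solve-∀

  crossed straight : Fin r → Fin r → ℕ
  crossed  s t = a s * b t + a t * b s
  straight s t = a s * b s + a t * b t

  crossed≤straight : SameOrder → ∀ s t → crossed s t ≤ straight s t
  crossed≤straight order s t with order s t
  ... | inj₁ (p , q) = rearrangement p q
  ... | inj₂ (p , q) = subst₂ _≤_ (+-comm (a t * b s) _) (+-comm (a t * b t) _) (rearrangement p q)

  ∑-crossed : ∑ F (λ s → ∑ F (crossed s)) ≡ 2 * (∑ F a * ∑ F b)
  ∑-crossed = begin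
    ∑ F (λ s → ∑ F (crossed s))                      ≡⟨ ∑-cong F inner ⟩
    ∑ F (λ s → ∑ F b * a s + ∑ F a * b s)            ≡⟨ ∑-distrib-+ F (λ s → ∑ F b * a s) (λ s → ∑ F a * b s) ⟩
    ∑ F (λ s → ∑ F b * a s) + ∑ F (λ s → ∑ F a * b s)
      ≡⟨ cong₂ _+_ (∑-distrib-*ˡ F (∑ F b) a) (∑-distrib-*ˡ F (∑ F a) b) ⟩
    ∑ F b * ∑ F a + ∑ F a * ∑ F b                    ≡⟨ double (∑ F a) (∑ F b) ⟩
    2 * (∑ F a * ∑ F b)                              ∎
    where
    open ≡-Reasoning
    double : ∀ x y → y * x + x * y ≡ 2 * (x * y)
    double = solve-∀
    inner : ∀ s → ∑ F (crossed s) ≡ ∑ F b * a s + ∑ F a * b s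
    inner s = trans (∑-distrib-+ F (λ t → a s * b t) (λ t → a t * b s))
      (cong₂ _+_ (trans (∑-distrib-*ˡ F (a s) b) (*-comm (a s) _))
                 (trans (∑-cong F (λ t → *-comm (a t) (b s)))
                        (trans (∑-distrib-*ˡ F (b s) a) (*-comm (b s) _))))

  ∑-straight : ∑ F (λ s → ∑ F (straight s)) ≡ 2 * (r * S)
  ∑-straight = begin
    ∑ F (λ s → ∑ F (straight s))              ≡⟨ ∑-cong F (λ s → trans (∑-distrib-+ F (λ _ → a s * b s) (λ t → a t * b t))
                                                                    (cong (_+ S) (∑-const r (a s * b s)))) ⟩
    ∑ F (λ s → r * (a s * b s) + S)           ≡⟨ ∑-distrib-+ F (λ s → r * (a s * b s)) (λ _ → S) ⟩
    ∑ F (λ s → r * (a s * b s)) + ∑ F (λ _ → S) ≡⟨ cong₂ _+_ (∑-distrib-*ˡ F r _) (∑-const r S) ⟩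
    r * S + r * S                             ≡⟨ double (r * S) ⟩
    2 * (r * S)                               ∎
    where
    open ≡-Reasoning
    double : ∀ x → x + x ≡ 2 * x
    double = solve-∀

  -- Summed over all r² ordered pairs of indices, the crossed products give twice the product of the
  -- totals and the straight ones twice r * S; for each pair the rearrangement inequality compares
  -- them.
  chebyshev : SameOrder → ∑ F a * ∑ F b ≤ r * S
  chebyshev order = *-cancelˡ-≤ 2 (subst₂ _≤_ ∑-crossed ∑-straight
    (∑-mono F (λ s → ∑-mono F (crossed≤straight order s))))

  -- Equality of the sums forces equality in every pairwise rearrangement, so no two indices can be
  -- strictly ordered in both sequences at once.
  chebyshev-tight : SameOrder → r * S ≤ ∑ F a * ∑ F b → ∀ {s t} → s ∈ F → t ∈ F → straight s t ≤ crossed s t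
  chebyshev-tight order le {s} s∈ =
    ∑-tight (crossed≤straight order s)
      (∑-tight (λ s → ∑-mono F (crossed≤straight order s))
        (subst₂ _≤_ (sym ∑-straight) (sym ∑-crossed) (*-monoʳ-≤ 2 le)) s∈)

-- Pigeonhole principle

-- Each test is settled by keeping the larger of the two halves, at the price of a factor 2.
pigeonhole : (is : List A) (J : A → Bool) (P : B → A → Bool) (bs : List B) →
  Σ (A → Bool) λ J′ →
    (∀ b → b ∈ bs → ∀ i j → J′ i ≡ true → J′ j ≡ true → P b i ≡ P b j) ×
    ∑ is (⟦_⟧ ∘ J) ≤ 2 ^ length bs * ∑ is (⟦_⟧ ∘ J′) × (∀ i → J′ i ≡ true → J i ≡ true)
pigeonhole is J P [] = J , (λ _ ()) , ≤-reflexive (sym (+-identityʳ _)) , λ _ p → p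
pigeonhole {A = A} is J P (b ∷ bs) = choose (≤-total (♯ J⁻) (♯ J⁺))
  where
  Goal : Set
  Goal = Σ (A → Bool) λ J′ →
    (∀ c → c ∈ b ∷ bs → ∀ i j → J′ i ≡ true → J′ j ≡ true → P c i ≡ P c j) ×
    ∑ is (⟦_⟧ ∘ J) ≤ 2 ^ length (b ∷ bs) * ∑ is (⟦_⟧ ∘ J′) × (∀ i → J′ i ≡ true → J i ≡ true)
  ♯ : (A → Bool) → ℕ
  ♯ K = ∑ is (⟦_⟧ ∘ K)
  J⁺ J⁻ : A → Bool
  J⁺ i = J i ∧ P b i
  J⁻ i = J i ∧ not (P b i)
  split : ∀ x y → ⟦ x ⟧ ≡ ⟦ x ∧ y ⟧ + ⟦ x ∧ not y ⟧
  split true  true  = refl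
  split true  false = refl
  split false _     = refl
  ♯-split : ♯ J ≡ ♯ J⁺ + ♯ J⁻
  ♯-split = trans (∑-cong is (λ i → split (J i) (P b i))) (∑-distrib-+ is (⟦_⟧ ∘ J⁺) (⟦_⟧ ∘ J⁻))
  ∧-true : ∀ x {y} → x ∧ y ≡ true → x ≡ true × y ≡ true
  ∧-true true e = refl , e
  continue : ∀ K y → ♯ J ≤ 2 * ♯ K → (∀ i → K i ≡ true → J i ≡ true × P b i ≡ y) → Goal
  continue K y le sub with pigeonhole is K P bs
  ... | J′ , const , le′ , sub′ =
    J′ , const′ ,
    ≤-trans le (≤-trans (*-monoʳ-≤ 2 le′) (≤-reflexive (sym (*-assoc 2 (2 ^ length bs) _)))) ,
    λ i p → proj₁ (sub i (sub′ i p))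
    where
    const′ : ∀ c → c ∈ b ∷ bs → ∀ i j → J′ i ≡ true → J′ j ≡ true → P c i ≡ P c j
    const′ c (here refl) i j p q = trans (proj₂ (sub i (sub′ i p))) (sym (proj₂ (sub j (sub′ j q))))
    const′ c (there c∈)  i j p q = const c c∈ i j p q
  choose : ♯ J⁻ ≤ ♯ J⁺ ⊎ ♯ J⁺ ≤ ♯ J⁻ → Goal
  choose (inj₁ le) = continue J⁺ true
    (≤-trans (≤-reflexive ♯-split) (≤-trans (+-monoʳ-≤ (♯ J⁺) le)
      (≤-reflexive (cong (♯ J⁺ +_) (sym (+-identityʳ _))))))
    (λ i → ∧-true (J i))
  choose (inj₂ le) = continue J⁻ false
    (≤-trans (≤-reflexive ♯-split) (≤-trans (+-monoˡ-≤ (♯ J⁻) le)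
      (≤-reflexive (cong (♯ J⁻ +_) (sym (+-identityʳ _))))))
    (λ i p → proj₁ (∧-true (J i) p) , Bool.not-injective (proj₂ (∧-true (J i) p)))

-- Weighted graphs

mass-+ˡ : ∀ (xs : List A) {X Y Z : A → ℕ} φ → (∀ x → X x ≡ Y x + Z x) →
          mass xs X φ ≡ mass xs Y φ + mass xs Z φ
mass-+ˡ xs {Y = Y} {Z} φ e =
  trans (∑-cong xs (λ x → trans (cong (_* φ x) (e x)) (*-distribʳ-+ (φ x) (Y x) (Z x)))) (∑-distrib-+ xs _ _)

mass-absorb : ∀ (xs : List A) (X χ φ : A → ℕ) → mass xs (λ x → X x * χ x) φ ≡ mass xs X (λ x → χ x * φ x)
mass-absorb xs X χ φ = ∑-cong xs (λ x → *-assoc (X x) (χ x) (φ x))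

bimass-absorb : ∀ (xs : List A) (X Y χ ψ : A → ℕ) (K : A → A → ℕ) →
  bimass xs (λ x → X x * χ x) (λ y → Y y * ψ y) K ≡ bimass xs X Y (λ x y → χ x * (ψ y * K x y))
bimass-absorb xs X Y χ ψ K = trans (mass-absorb xs X χ (λ x → mass xs (λ y → Y y * ψ y) (K x))) (mass-cong xs X (λ x →
  trans (cong (χ x *_) (mass-absorb xs Y ψ (K x))) (sym (mass-*ˡ xs Y (χ x) (λ y → ψ y * K x y)))))

∑-mass : ∀ (xs : List A) X → ∑ xs X ≡ mass xs X (λ _ → 1)
∑-mass xs X = ∑-cong xs (λ x → sym (*-identityʳ (X x)))

module WeightedGraph {A : Set} (vs : List A) (complete : ∀ x → x ∈ vs)
  (adj : A → A → Bool) (adj-sym : ∀ u v → adj u v ≡ adj v u) where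

  open Cliques adj public

  ad nad : A → A → ℕ
  ad  u v = ⟦ adj u v ⟧
  nad u v = ⟦ not (adj u v) ⟧

  nad-sym : ∀ u v → nad u v ≡ nad v u
  nad-sym u v = cong (⟦_⟧ ∘ not) (adj-sym u v)

  ad+nad : ∀ u v → ad u v + nad u v ≡ 1
  ad+nad u v with adj u v
  ... | true  = refl
  ... | false = refl

  ad≤1 : ∀ u v → ad u v ≤ 1
  ad≤1 u v = ⟦⟧≤1 (adj u v)

  mono : ∀ {r} → (A → Fin r) → A → A → ℕ
  mono c u v = ad u v * δ (c u) (c v)

  empty : ∀ {P : A → Set} → Clique P 0
  empty = clique (λ ()) (λ ()) (λ ())

  clique? : ∀ {P : A → Set} → Decidable P → ∀ m → Dec (Clique P m)
  clique? P? zero    = yes empty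
  clique? P? (suc m) with Any.any? (λ x → P? x ×-dec clique? (λ y → P? y ×-dec (adj x y Bool.≟ true)) m) vs
  ... | yes p with find p
  ...   | x , _ , px , K = yes (extend adj-sym x px (restrict adj-sym proj₁ K) (proj₂ ∘ Clique.inside K))
  clique? P? (suc m) | no ¬p = no λ K → ¬p (lose (complete (Clique.vertex K zero))
    (Clique.inside K zero , clique (Clique.vertex K ∘ suc)
      (λ a → Clique.inside K (suc a) , Clique.adjacent K zero (suc a) (λ ()))
      (λ a b ne → Clique.adjacent K (suc a) (suc b) (ne ∘ suc-injective))))

  -- Only vertices of positive weight compete, because the stability induction passes to a
  -- neighbourhood by setting all other weights to zero.
  argmin : ∀ (w z : A → ℕ) → 0 < ∑ vs w → ∃[ x ] 0 < w x × (∀ y → 0 < w y → z x ≤ z y)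
  argmin w z pos with ∑-pos vs pos
  ... | x₀ , wx₀ with best vs
    where
    best : ∀ xs → ∃[ x ] 0 < w x × (∀ y → y ∈ xs → 0 < w y → z x ≤ z y)
    best [] = x₀ , wx₀ , λ _ ()
    best (x′ ∷ xs) with best xs
    ... | x , wx , min with 0 <? w x′ | z x ≤? z x′
    ... | yes wx′ | no ¬le = x′ , wx′ , λ where
      y (here refl) _  → ≤-refl
      y (there y∈)  wy → ≤-trans (<⇒≤ (≰⇒> ¬le)) (min y y∈ wy)
    ... | _       | yes le = x , wx , λ where
      y (here refl) _  → le
      y (there y∈)  wy → min y y∈ wy
    ... | no ¬wx′ | no _   = x , wx , λ where
      y (here refl) wy → contradiction wy ¬wx′
      y (there y∈)  wy → min y y∈ wy
  ... | x , wx , min = x , wx , λ y → min y (complete y)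

  bimass-ad+nad : ∀ X Y → bimass vs X Y ad + bimass vs X Y nad ≡ ∑ vs X * ∑ vs Y
  bimass-ad+nad X Y = begin
    bimass vs X Y ad + bimass vs X Y nad      ≡⟨ sym (bimass-+ vs X Y ad nad) ⟩
    bimass vs X Y (λ u v → ad u v + nad u v)  ≡⟨ bimass-cong vs X Y ad+nad ⟩
    bimass vs X Y (λ u v → 1 * 1)             ≡⟨ bimass-× vs X Y (λ _ → 1) (λ _ → 1) ⟩
    mass vs X (λ _ → 1) * mass vs Y (λ _ → 1) ≡⟨ cong₂ _*_ (sym (∑-mass vs X)) (sym (∑-mass vs Y)) ⟩
    ∑ vs X * ∑ vs Y                           ∎
    where open ≡-Reasoning

  mono≤ad : ∀ {r} (c : A → Fin r) u v → mono c u v ≤ ad u v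
  mono≤ad c u v = subst (mono c u v ≤_) (*-identityʳ (ad u v)) (*-monoʳ-≤ (ad u v) (⟦⟧≤1 _))

  private
    -- Δ and γ are the weights of the neighbourhood and of the new class; a and e are the
    -- monochromatic weights inside them; zₙ, y, z are the missing weights inside the neighbourhood,
    -- across, and inside the new class. At its heart is (Δ+γ)²/(R+1) ≤ Δ²/R + γ², which is AM-GM
    -- for Δ and Rγ.
    stability-arithmetic : ∀ R Δ γ a e zₙ y z → Δ * Δ + suc R * a ≤ suc R * zₙ → e + z ≡ γ * γ → γ * γ ≤ y + z →
      (Δ + γ) * (Δ + γ) + suc (suc R) * (a + e) ≤ suc (suc R) * (zₙ + y + (y + z))
    stability-arithmetic R₀ Δ γ a e zₙ y z h₁ h₂ h₃ = *-cancelˡ-≤ R (linear 0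
      (+-mono-≤ (+-mono-≤ (*-monoʳ-≤ (suc R) h₁) (am-gm Δ (R * γ)))
                (+-mono-≤ (*-monoʳ-≤ (2 * R * suc R) e≤y) (*-monoʳ-≤ (R * suc R) (≤-reflexive (sym h₂)))))
      (shuffle R Δ γ a e zₙ y z))
      where
      R = suc R₀
      -- Edges inside the new class weigh no more than the non-edges leaving it: this is where the
      -- maximum degree enters.
      e≤y : e ≤ y
      e≤y = +-cancelʳ-≤ z e y (subst (_≤ y + z) (sym h₂) h₃)
      shuffle : ∀ R Δ γ a e zₙ y z →
        R * ((Δ + γ) * (Δ + γ) + suc R * (a + e)) +
          (suc R * (R * zₙ) + (Δ * Δ + R * γ * (R * γ)) + (2 * R * suc R * y + R * suc R * (e + z))) + 0 ≡
        R * (suc R * (zₙ + y + (y + z))) +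
          (suc R * (Δ * Δ + R * a) + 2 * (Δ * (R * γ)) + (2 * R * suc R * e + R * suc R * (γ * γ)))
      shuffle = solve-∀

  -- Füredi's stability version of Turán's theorem: the non-neighbours of a vertex of
  -- maximum degree receive a new colour and its neighbourhood is coloured recursively.
  stability : ∀ r (w : A → ℕ) → Clique (λ x → 0 < w x) (suc (suc r)) ⊎
    Σ (A → Fin (suc r)) λ c →
      ∑ vs w * ∑ vs w + suc r * bimass vs w w (mono c) ≤ suc r * bimass vs w w nad
  stability zero w with 0 <? bimass vs w w ad
  ... | yes pos with ∑-pos vs pos
  ...   | u , pu with ∑-pos vs (0<*ʳ {w u} pu)
  ...     | v , pv = inj₁ (extend adj-sym u (0<*ˡ pu)
              (extend adj-sym v (0<*ˡ pv) empty λ ()) λ where zero → ⟦⟧-true (0<*ʳ {w v} pv))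
  stability zero w | no ¬pos = inj₂ ((λ _ → zero) , (begin
    ∑ vs w * ∑ vs w + 1 * bimass vs w w m     ≡⟨ cong (_+ 1 * bimass vs w w m) (sym (bimass-ad+nad w w)) ⟩
    e + bimass vs w w nad + 1 * bimass vs w w m ≤⟨ +-monoʳ-≤ (e + bimass vs w w nad) (*-monoʳ-≤ 1 (bimass-mono vs w w (mono≤ad {1} (λ _ → zero)))) ⟩
    e + bimass vs w w nad + 1 * e             ≡⟨ cong (λ e → e + bimass vs w w nad + 1 * e) (n≤0⇒n≡0 (≮⇒≥ ¬pos)) ⟩
    bimass vs w w nad + 0                     ∎))
    where
    open ≤-Reasoning
    e = bimass vs w w ad
    m = mono {1} (λ _ → zero)
  stability (suc r) w with 0 <? ∑ vs w
  ... | no ¬pos = inj₂ ((λ _ → zero) , (begin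
    W * W + R * bimass vs w w m     ≤⟨ +-monoʳ-≤ (W * W) (*-monoʳ-≤ R (bimass-mono vs w w (mono≤ad {R} (λ _ → zero)))) ⟩
    W * W + R * bimass vs w w ad    ≤⟨ +-monoʳ-≤ (W * W) (*-monoʳ-≤ R (m≤m+n (bimass vs w w ad) (bimass vs w w nad))) ⟩
    W * W + R * (bimass vs w w ad + bimass vs w w nad) ≡⟨ cong (λ x → W * W + R * x) (bimass-ad+nad w w) ⟩
    W * W + R * (W * W)             ≡⟨ cong (λ x → x * x + R * (x * x)) (n≤0⇒n≡0 (≮⇒≥ ¬pos)) ⟩
    R * 0                           ≤⟨ *-monoʳ-≤ R (z≤n {bimass vs w w nad}) ⟩
    R * bimass vs w w nad           ∎))
    where
    open ≤-Reasoning
    W = ∑ vs w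
    R = suc (suc r)
    m = mono {R} (λ _ → zero)
  ... | yes pos with argmin w (λ x → mass vs w (nad x)) pos
  ...   | x , wx , min = step (stability r w₁)
    where
    w₁ w₂ : A → ℕ
    w₁ y = w y * ad x y
    w₂ y = w y * nad x y
    split : ∀ y → w y ≡ w₁ y + w₂ y
    split y = trans (sym (*-identityʳ (w y))) (trans (cong (w y *_) (sym (ad+nad x y))) (*-distribˡ-+ (w y) _ _))
    bimass-split : ∀ K → bimass vs w w K ≡ bimass vs w₁ w₁ K + bimass vs w₁ w₂ K + (bimass vs w₂ w₁ K + bimass vs w₂ w₂ K)
    bimass-split K = trans (mass-+ˡ vs {w} {w₁} {w₂} (λ u → mass vs w (K u)) split) (cong₂ _+_ (inner w₁) (inner w₂))
      where
      inner : ∀ X → mass vs X (λ u → mass vs w (K u)) ≡ bimass vs X w₁ K + bimass vs X w₂ K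
      inner X = trans (mass-cong vs X (λ u → mass-+ˡ vs {w} {w₁} {w₂} (K u) split)) (mass-+ vs X (λ u → mass vs w₁ (K u)) (λ u → mass vs w₂ (K u)))
    step : Clique (λ y → 0 < w₁ y) (suc (suc r)) ⊎ (Σ (A → Fin (suc r)) λ c →
             ∑ vs w₁ * ∑ vs w₁ + suc r * bimass vs w₁ w₁ (mono c) ≤ suc r * bimass vs w₁ w₁ nad) → _
    step (inj₁ K) = inj₁ (extend adj-sym x wx (restrict adj-sym 0<*ˡ K)
      (λ a → ⟦⟧-true (0<*ʳ {w (Clique.vertex K a)} (Clique.inside K a))))
    step (inj₂ (c′ , h)) = inj₂ (c , subst₂ _≤_ (cong₂ _+_ (cong₂ _*_ W≡ W≡) (cong (λ x → suc (suc r) * x) (sym mono-split)))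
        (cong (λ x → suc (suc r) * x) (sym nad-split))
        (stability-arithmetic r (∑ vs w₁) (∑ vs w₂) (bimass vs w₁ w₁ (mono c′)) (bimass vs w₂ w₂ ad)
          (bimass vs w₁ w₁ nad) (bimass vs w₂ w₁ nad) (bimass vs w₂ w₂ nad) h (bimass-ad+nad w₂ w₂) max-degree))
      where
      c : A → Fin (suc (suc r))
      c y = if adj x y then suc (c′ y) else zero
      W≡ : ∑ vs w₁ + ∑ vs w₂ ≡ ∑ vs w
      W≡ = sym (trans (∑-cong vs split) (∑-distrib-+ vs w₁ w₂))
      nad-split : bimass vs w w nad ≡
        bimass vs w₁ w₁ nad + bimass vs w₂ w₁ nad + (bimass vs w₂ w₁ nad + bimass vs w₂ w₂ nad)
      nad-split = trans (bimass-split nad) (cong (λ y → bimass vs w₁ w₁ nad + y + (bimass vs w₂ w₁ nad + bimass vs w₂ w₂ nad))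
        (trans (mass-swap vs vs w₁ w₂ nad) (bimass-cong vs w₂ w₁ {λ u v → nad v u} {nad} (λ u v → nad-sym v u))))
      colour-cases : ∀ u v → mono c u v ≡
        ad x u * (ad x v * mono c′ u v) + nad x u * (nad x v * ad u v)
      colour-cases u v with adj x u | adj x v
      ... | true  | true  = trans (cong (ad u v *_) (δ-suc (c′ u) (c′ v))) (ring (mono c′ u v))
        where
        ring : ∀ x → x ≡ 1 * (1 * x) + 0
        ring = solve-∀
      ... | true  | false = *-zeroʳ (ad u v)
      ... | false | true  = *-zeroʳ (ad u v)
      ... | false | false = ring (ad u v)
        where
        ring : ∀ x → x * 1 ≡ 1 * (1 * x)
        ring = solve-∀
      mono-split : bimass vs w w (mono c) ≡ bimass vs w₁ w₁ (mono c′) + bimass vs w₂ w₂ ad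
      mono-split = trans (bimass-cong vs w w colour-cases) (trans (bimass-+ vs w w (λ u v → ad x u * (ad x v * mono c′ u v)) (λ u v → nad x u * (nad x v * ad u v)))
        (cong₂ _+_ (sym (bimass-absorb vs w w (ad x) (ad x) (mono c′)))
                   (sym (bimass-absorb vs w w (nad x) (nad x) ad))))
      -- `∑ vs w₂` is the non-neighbour weight of x, hence a lower bound for that of every vertex of
      -- positive weight; the bound is summed over the new class.
      max-degree : ∑ vs w₂ * ∑ vs w₂ ≤ bimass vs w₂ w₁ nad + bimass vs w₂ w₂ nad
      max-degree = begin
        ∑ vs w₂ * ∑ vs w₂                               ≡⟨ cong (_* ∑ vs w₂) (∑-mass vs w₂) ⟩
        mass vs w₂ (λ _ → 1) * ∑ vs w₂                  ≡⟨ sym (mass-*ʳ vs w₂ (∑ vs w₂) (λ _ → 1)) ⟩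
        mass vs w₂ (λ _ → 1 * ∑ vs w₂)                  ≤⟨ ∑-mono vs minimal ⟩
        mass vs w₂ (λ u → mass vs w (nad u))            ≡⟨ mass-cong vs w₂ (λ u → mass-+ˡ vs {w} {w₁} {w₂} (nad u) split) ⟩
        mass vs w₂ (λ u → mass vs w₁ (nad u) + mass vs w₂ (nad u)) ≡⟨ mass-+ vs w₂ (λ u → mass vs w₁ (nad u)) (λ u → mass vs w₂ (nad u)) ⟩
        bimass vs w₂ w₁ nad + bimass vs w₂ w₂ nad       ∎
        where
        open ≤-Reasoning
        minimal : ∀ u → w₂ u * (1 * ∑ vs w₂) ≤ w₂ u * mass vs w (nad u)
        minimal u with 0 <? w u
        ... | yes wu = *-monoʳ-≤ (w₂ u) (subst (_≤ mass vs w (nad u)) (sym (+-identityʳ _)) (min u wu))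
        ... | no ¬wu = subst (λ k → k * nad x u * (1 * ∑ vs w₂) ≤ w₂ u * mass vs w (nad u)) (sym (n≤0⇒n≡0 (≮⇒≥ ¬wu))) z≤n

mass-∑ : ∀ (xs : List A) (ts : List B) X (f : A → B → ℕ) →
         mass xs X (λ x → ∑ ts (f x)) ≡ ∑ ts (λ t → mass xs X (λ x → f x t))
mass-∑ xs ts X f =
  trans (∑-cong xs (λ x → sym (∑-distrib-*ˡ ts (X x) (f x)))) (∑-swap xs ts (λ x t → X x * f x t))

⟦<⟧*≤ : ∀ {a b} (a<b? : Dec (a < b)) → ⟦ does a<b? ⟧ * a ≤ b
⟦<⟧*≤ {a} {b} (yes p) = subst (_≤ b) (sym (+-identityʳ a)) (<⇒≤ p)
⟦<⟧*≤ (no _)  = z≤n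

⟦⟧-false : ∀ {P : Set} (P? : Dec P) → ⟦ does P? ⟧ < 1 → ¬ P
⟦⟧-false (yes _) (s≤s ())
⟦⟧-false (no ¬p) _ = ¬p

-- Cliques with one vertex in each of several almost completely joined classes

module Transversal {A : Set} (vs : List A) (complete : ∀ x → x ∈ vs)
  (adj : A → A → Bool) (adj-sym : ∀ u v → adj u v ≡ adj v u) where

  open WeightedGraph vs complete adj adj-sym public

  -- Greedy choice: some vertex of the first class has, in each other class, a
  -- non-neighbourhood of at most a 1/m-fraction, and (1 - 1/m)² m² = (m - 1)².
  transversal : ∀ m {P : A → Set} (X : Fin m → A → ℕ) → (∀ s x → 0 < X s x → P x) →
    (∀ s → 0 < ∑ vs (X s)) →
    (∀ s t → s ≢ t → m * m * bimass vs (X s) (X t) nad < ∑ vs (X s) * ∑ vs (X t)) →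
    Clique P m
  transversal zero    X supp pos sparse = empty
  transversal (suc m) {P} X supp pos sparse = choose (∑-< vs few-bad)
    where
    m⁺ = suc m
    x₀ = ∑ vs (X zero)
    x : Fin m → ℕ
    x t = ∑ vs (X (suc t))
    deg : Fin m → A → ℕ
    deg t y = mass vs (X (suc t)) (nad y)
    bad : A → Fin m → ℕ
    bad y t = ⟦ does (x t <? m⁺ * deg t y) ⟧
    β : Fin m → ℕ
    β t = mass vs (X zero) (λ y → bad y t)

    bad-deg : ∀ t y → bad y t * x t ≤ m⁺ * deg t y
    bad-deg t y = ⟦<⟧*≤ (x t <? m⁺ * deg t y)

    -- Markov's inequality: each bad vertex misses more than a 1/m⁺ share of class t, so a bad
    -- weight above x₀ / m⁺ would exceed the missing weight that `sparse` permits.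
    β-small : ∀ t → m⁺ * β t ≤ x₀
    β-small t = <⇒≤ (*-cancelʳ-< (x t) _ _ (begin-strict
      m⁺ * β t * x t                             ≡⟨ *-assoc m⁺ (β t) (x t) ⟩
      m⁺ * (β t * x t)                           ≡⟨ cong (m⁺ *_) (sym (mass-*ʳ vs (X zero) (x t) (λ y → bad y t))) ⟩
      m⁺ * mass vs (X zero) (λ y → bad y t * x t) ≤⟨ *-monoʳ-≤ m⁺ (mass-mono vs (X zero) (bad-deg t)) ⟩
      m⁺ * mass vs (X zero) (λ y → m⁺ * deg t y)  ≡⟨ cong (m⁺ *_) (mass-*ˡ vs (X zero) m⁺ (deg t)) ⟩
      m⁺ * (m⁺ * bimass vs (X zero) (X (suc t)) nad) ≡⟨ sym (*-assoc m⁺ m⁺ _) ⟩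
      m⁺ * m⁺ * bimass vs (X zero) (X (suc t)) nad <⟨ sparse zero (suc t) (λ ()) ⟩
      x₀ * x t                                  ∎))
      where open ≤-Reasoning

    few-bad : mass vs (X zero) (λ y → ∑ (allFin m) (bad y)) < x₀
    few-bad = *-cancelˡ-< m⁺ _ _ (begin-strict
      m⁺ * mass vs (X zero) (λ y → ∑ (allFin m) (bad y)) ≡⟨ cong (m⁺ *_) (mass-∑ vs (allFin m) (X zero) bad) ⟩
      m⁺ * ∑ (allFin m) β             ≡⟨ sym (∑-distrib-*ˡ (allFin m) m⁺ β) ⟩
      ∑ (allFin m) (λ t → m⁺ * β t)   ≤⟨ ∑-mono (allFin m) β-small ⟩
      ∑ (allFin m) (λ _ → x₀)        ≡⟨ ∑-const m x₀ ⟩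
      m * x₀                         <⟨ m<n+m (m * x₀) (pos zero) ⟩
      m⁺ * x₀                         ∎)
      where open ≤-Reasoning

    choose : (∃[ y ] X zero y * ∑ (allFin m) (bad y) < X zero y) → Clique P m⁺
    choose (y , lt) = extend adj-sym y (supp zero y (≤-<-trans z≤n lt))
        (restrict adj-sym proj₁ rest) (proj₂ ∘ Clique.inside rest)
      where
      no-bad : ∑ (allFin m) (bad y) < 1
      no-bad = *-cancelˡ-< (X zero y) _ _ (subst (X zero y * ∑ (allFin m) (bad y) <_) (sym (*-identityʳ (X zero y))) lt)

      good : ∀ t → m⁺ * deg t y ≤ x t
      good t = ≮⇒≥ (⟦⟧-false (x t <? m⁺ * deg t y) (≤-<-trans (∑-∈ (bad y) (∈-allFin t)) no-bad))

      X′ : Fin m → A → ℕ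
      X′ t v = X (suc t) v * ad y v
      x′ : Fin m → ℕ
      x′ t = ∑ vs (X′ t)

      x′+deg : ∀ t → x′ t + deg t y ≡ x t
      x′+deg t = trans (sym (mass-+ vs (X (suc t)) (ad y) (nad y)))
        (trans (mass-cong vs (X (suc t)) (ad+nad y)) (sym (∑-mass vs (X (suc t)))))

      large : ∀ t → m * x t ≤ m⁺ * x′ t
      large t = linear 0 (good t) (subst (λ z → m * z + z + 0 ≡ m⁺ * x′ t + m⁺ * deg t y) (x′+deg t)
        (shuffle m (x′ t) (deg t y)))
        where
        shuffle : ∀ m a b → m * (a + b) + (a + b) + 0 ≡ suc m * a + suc m * b
        shuffle = solve-∀

      0<m : Fin m → 0 < m
      0<m zero    = s≤s z≤n
      0<m (suc _) = s≤s z≤n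

      sparse′ : ∀ s t → s ≢ t → m * m * bimass vs (X′ s) (X′ t) nad < x′ s * x′ t
      sparse′ s t s≢t = *-cancelˡ-< (m⁺ * m⁺) _ _ (begin-strict
        m⁺ * m⁺ * (m * m * bimass vs (X′ s) (X′ t) nad) ≤⟨ *-monoʳ-≤ (m⁺ * m⁺) (*-monoʳ-≤ (m * m) (bimass-monoˡ vs nad (shrink s) (shrink t))) ⟩
        m⁺ * m⁺ * (m * m * K)        ≡⟨ shuffle₁ m⁺ m K ⟩
        m * m * (m⁺ * m⁺ * K)        <⟨ *-monoʳ-< (m * m) {{>-nonZero (*-pos (0<m s) (0<m s))}} (sparse (suc s) (suc t) (s≢t ∘ suc-injective)) ⟩
        m * m * (x s * x t)        ≡⟨ shuffle₂ m (x s) (x t) ⟩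
        m * x s * (m * x t)        ≤⟨ *-mono-≤ (large s) (large t) ⟩
        m⁺ * x′ s * (m⁺ * x′ t)      ≡⟨ sym (shuffle₂ m⁺ (x′ s) (x′ t)) ⟩
        m⁺ * m⁺ * (x′ s * x′ t)      ∎)
        where
        open ≤-Reasoning
        K = bimass vs (X (suc s)) (X (suc t)) nad
        shrink : ∀ s v → X′ s v ≤ X (suc s) v
        shrink s v = subst (X′ s v ≤_) (*-identityʳ _) (*-monoʳ-≤ (X (suc s) v) (ad≤1 y v))
        shuffle₁ : ∀ m⁺ m k → m⁺ * m⁺ * (m * m * k) ≡ m * m * (m⁺ * m⁺ * k)
        shuffle₁ = solve-∀
        shuffle₂ : ∀ m a b → m * m * (a * b) ≡ m * a * (m * b)
        shuffle₂ = solve-∀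

      rest : Clique (λ v → P v × adj y v ≡ true) m
      rest = transversal m X′
        (λ t v lt → supp (suc t) v (0<*ˡ lt) , ⟦⟧-true (0<*ʳ {X (suc t) v} lt))
        (λ t → 0<*ʳ {m⁺} (<-≤-trans (*-pos (0<m t) (pos (suc t))) (large t)))
        sparse′

  -- The defect from the complete r-partite graph of the colouring. Differently coloured pairs
  -- inside one part of G count as missing too; `missᵖ` leaves them out.
  miss : ∀ {r} → (A → Fin r) → A → A → ℕ
  miss c u v = nad u v * δ̅ (c u) (c v)

  -- ι selects the colours to be used and h cuts their classes down to a (common) neighbourhood. Two
  -- cut classes have weights above T / d each, so their product dominates m² times all missing
  -- pairs, and `transversal` applies.
  rainbow-clique : ∀ {r} (c : A → Fin r) (X : A → ℕ) m (ι : Fin m → Fin r) →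
    (∀ {s t} → ι s ≡ ι t → s ≡ t) → (h : A → Bool) → ∀ d T →
    d * d * (m * m * bimass vs X X (miss c)) ≤ T * T →
    (∀ s → T < d * mass vs X (λ v → δ (c v) (ι s) * ⟦ h v ⟧)) →
    Clique (λ v → h v ≡ true) m
  rainbow-clique c X m ι ι-inj h d T sparse large = transversal m Y
    (λ s v lt → ⟦⟧-true (0<*ʳ {δ (c v) (ι s)} (0<*ʳ {X v} lt)))
    (λ s → 0<*ʳ {d} (≤-<-trans z≤n (large s)))
    (λ s t s≢t → *-cancelˡ-< (d * d) _ _ (begin-strict
      d * d * (m * m * bimass vs (Y s) (Y t) nad)      ≤⟨ *-monoʳ-≤ (d * d) (*-monoʳ-≤ (m * m) (between s t s≢t)) ⟩
      d * d * (m * m * bimass vs X X (miss c)) ≤⟨ sparse ⟩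
      T * T                                    <⟨ *-mono-< (large s) (large t) ⟩
      d * y s * (d * y t)                      ≡⟨ shuffle d (y s) (y t) ⟩
      d * d * (y s * y t)                      ∎))
    where
    open ≤-Reasoning
    χ : Fin m → A → ℕ
    χ s v = δ (c v) (ι s) * ⟦ h v ⟧
    Y : Fin m → A → ℕ
    Y s v = X v * χ s v
    y : Fin m → ℕ
    y s = ∑ vs (Y s)
    shuffle : ∀ d a b → d * a * (d * b) ≡ d * d * (a * b)
    shuffle = solve-∀
    pointwise : ∀ s t → s ≢ t → ∀ u v → χ s u * (χ t v * nad u v) ≤ miss c u v
    pointwise s t s≢t u v with c u ≟ ι s | c v ≟ ι t
    ... | no _  | _     = z≤n
    ... | yes _ | no _  = ≤-trans (≤-reflexive (*-zeroʳ (1 * ⟦ h u ⟧))) z≤n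
    ... | yes p | yes q = subst (λ e → 1 * ⟦ h u ⟧ * (1 * ⟦ h v ⟧ * nad u v) ≤ nad u v * e)
      (sym (δ̅-≢ (λ e → s≢t (ι-inj (trans (sym p) (trans e q))))))
      (≤-trans (*-mono-≤ (*-monoʳ-≤ 1 (⟦⟧≤1 (h u))) (*-monoˡ-≤ (nad u v) (*-monoʳ-≤ 1 (⟦⟧≤1 (h v)))))
               (≤-reflexive (ring (nad u v))))
      where
      ring : ∀ a → 1 * (1 * a) ≡ a * 1
      ring = solve-∀
    between : ∀ s t → s ≢ t → bimass vs (Y s) (Y t) nad ≤ bimass vs X X (miss c)
    between s t s≢t = ≤-trans (≤-reflexive (bimass-absorb vs X X (χ s) (χ t) nad))
      (bimass-mono vs X X (pointwise s t s≢t))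

-- Partite graphs

-- Keeps the weights N / |V_i| within the natural numbers.
common-multiple : ∀ n (f : Fin n → ℕ) → (∀ i → 0 < f i) →
  Σ ℕ λ N → 0 < N × Σ (Fin n → ℕ) λ g → ∀ i → g i * f i ≡ N
common-multiple zero    f pos = 1 , s≤s z≤n , (λ ()) , λ ()
common-multiple (suc n) f pos with common-multiple n (f ∘ suc) (pos ∘ suc)
... | N , 0<N , g , eq = f zero * N , *-pos (pos zero) 0<N , g′ , eq′
  where
  g′ : Fin (suc n) → ℕ
  g′ zero    = N
  g′ (suc i) = f zero * g i
  eq′ : ∀ i → g′ i * f i ≡ f zero * N
  eq′ zero    = *-comm N (f zero)
  eq′ (suc i) = trans (*-assoc (f zero) (g i) _) (cong (f zero *_) (eq i))

module Parts {ℓ} (G : PartiteGraph ℓ) where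

  V : Set
  V = Vertex G

  vertices : List V
  vertices = concatMap (λ i → map (i ,_) (allFin (size G i))) (allFin ℓ)

  vertices-complete : ∀ v → v ∈ vertices
  vertices-complete (i , a) =
    ∈-concatMap⁺ (λ i → map (i ,_) (allFin (size G i))) (lose (∈-allFin i) (∈-map⁺ (i ,_) (∈-allFin a)))

  open Transversal vertices vertices-complete (adj G) (symm G) public

  parts : List (Fin ℓ)
  parts = allFin ℓ

  private
    weighting = common-multiple ℓ (size G) (nonempty G)

  N : ℕ
  N = proj₁ weighting

  0<N : 0 < N
  0<N = proj₁ (proj₂ weighting)

  ω : Fin ℓ → ℕ
  ω = proj₁ (proj₂ (proj₂ weighting))

  ω*size : ∀ i → ω i * size G i ≡ N
  ω*size = proj₂ (proj₂ (proj₂ weighting))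

  0<ω : ∀ i → 0 < ω i
  0<ω i = 0<*ˡ (subst (0 <_) (sym (ω*size i)) 0<N)

  weight : (Fin ℓ → Bool) → V → ℕ
  weight J u = ⟦ J (proj₁ u) ⟧ * ω (proj₁ u)

  part : Fin ℓ → (V → ℕ) → ℕ
  part i φ = mass (allFin (size G i)) (λ _ → ω i) (λ a → φ (i , a))

  pair : (V → V → ℕ) → Fin ℓ → Fin ℓ → ℕ
  pair K i j = part i (λ u → part j (K u))

  mass-parts : ∀ J φ → mass vertices (weight J) φ ≡ mass parts (⟦_⟧ ∘ J) (λ i → part i φ)
  mass-parts J φ = trans
    (∑-concatMap (λ i → map (i ,_) (allFin (size G i))) parts (λ x → weight J x * φ x))
    (∑-cong parts (λ i → trans (∑-map (i ,_) (allFin (size G i)) (λ x → weight J x * φ x))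
      (trans (∑-cong (allFin (size G i)) (λ a → *-assoc ⟦ J i ⟧ (ω i) (φ (i , a))))
             (∑-distrib-*ˡ (allFin (size G i)) ⟦ J i ⟧ (λ a → ω i * φ (i , a))))))

  bimass-parts : ∀ J K → bimass vertices (weight J) (weight J) K ≡ bimass parts (⟦_⟧ ∘ J) (⟦_⟧ ∘ J) (pair K)
  bimass-parts J K = trans (mass-parts J (λ u → mass vertices (weight J) (K u))) (mass-cong parts (⟦_⟧ ∘ J) (λ i →
    trans (mass-cong (allFin (size G i)) (λ _ → ω i) (λ a → mass-parts J (K (i , a))))
          (mass-swap (allFin (size G i)) parts (λ _ → ω i) (⟦_⟧ ∘ J) (λ a j → part j (K (i , a))))))

  part-const : ∀ i k → part i (λ _ → k) ≡ k * N
  part-const i k = begin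
    ∑ (allFin (size G i)) (λ _ → ω i * k) ≡⟨ ∑-const (size G i) (ω i * k) ⟩
    size G i * (ω i * k)                  ≡⟨ shuffle (size G i) (ω i) k ⟩
    k * (ω i * size G i)                  ≡⟨ cong (k *_) (ω*size i) ⟩
    k * N                                 ∎
    where
    open ≡-Reasoning
    shuffle : ∀ a b c → a * (b * c) ≡ c * (b * a)
    shuffle = solve-∀

  pair-cong : ∀ i j {K L} → (∀ u v → K u v ≡ L u v) → pair K i j ≡ pair L i j
  pair-cong i j e = mass-cong (allFin (size G i)) (λ _ → ω i) (λ a →
    mass-cong (allFin (size G j)) (λ _ → ω j) (λ b → e (i , a) (j , b)))

  pair-mono : ∀ i j {K L} → (∀ u v → K u v ≤ L u v) → pair K i j ≤ pair L i j
  pair-mono i j e = mass-mono (allFin (size G i)) (λ _ → ω i) (λ a →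
    mass-mono (allFin (size G j)) (λ _ → ω j) (λ b → e (i , a) (j , b)))

  pair-+ : ∀ K L i j → pair (λ u v → K u v + L u v) i j ≡ pair K i j + pair L i j
  pair-+ K L i j = trans (mass-cong (allFin (size G i)) (λ _ → ω i) (λ a →
      mass-+ (allFin (size G j)) (λ _ → ω j) (λ b → K (i , a) (j , b)) (λ b → L (i , a) (j , b))))
    (mass-+ (allFin (size G i)) (λ _ → ω i) (λ a → part j (K (i , a))) (λ a → part j (L (i , a))))

  pair-ad+nad : ∀ i j → pair ad i j + pair nad i j ≡ N * N
  pair-ad+nad i j = begin
    pair ad i j + pair nad i j           ≡⟨ sym (pair-+ ad nad i j) ⟩
    pair (λ u v → ad u v + nad u v) i j  ≡⟨ pair-cong i j ad+nad ⟩
    part i (λ _ → part j (λ _ → 1)) ≡⟨ part-const i (part j (λ _ → 1)) ⟩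
    part j (λ _ → 1) * N            ≡⟨ cong (_* N) (trans (part-const j 1) (+-identityʳ N)) ⟩
    N * N                           ∎
    where open ≡-Reasoning

  pair-ad : ∀ i j → pair ad i j ≡ ω i * (ω j * edgesBetween G i j)
  pair-ad i j = trans (∑-distrib-*ˡ (allFin (size G i)) (ω i) _) (cong (ω i *_)
    (trans (∑-cong (allFin (size G i)) (λ a → ∑-distrib-*ˡ (allFin (size G j)) (ω j) (λ b → ad (i , a) (j , b))))
           (∑-distrib-*ˡ (allFin (size G i)) (ω j) _)))

  ∥_∥ : (Fin ℓ → Bool) → ℕ
  ∥ J ∥ = ∑ parts (⟦_⟧ ∘ J)

  total : ∀ J → mass vertices (weight J) (λ _ → 1) ≡ ∥ J ∥ * N
  total J = trans (mass-parts J (λ _ → 1)) (trans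
    (mass-cong parts (⟦_⟧ ∘ J) (λ i → trans (part-const i 1) (sym (*-comm N 1))))
    (trans (mass-*ˡ parts (⟦_⟧ ∘ J) N (λ _ → 1))
      (trans (cong (N *_) (sym (∑-mass parts (⟦_⟧ ∘ J)))) (*-comm N _))))

  module Density {r₀} (density : DensityCondition (suc (suc r₀)) G) where

    r : ℕ
    r = suc r₀

    pair-density : ∀ {i j} → i ≢ j → r * pair nad i j ≤ N * N
    pair-density {i} {j} i≢j = linear 0
      (+-mono-≤ (*-monoʳ-≤ (ω i) (*-monoʳ-≤ (ω j) (density i j i≢j))) (≤-refl {r * (N * N)}))
      (begin
          r * pair nad i j + (ω i * (ω j * (r * edgesBetween G i j)) + r * (N * N)) + 0
            ≡⟨ shuffle₁ r (pair nad i j) (ω i) (ω j) (edgesBetween G i j) (N * N) ⟩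
          r * (ω i * (ω j * edgesBetween G i j) + pair nad i j) + r * (N * N)
            ≡⟨ cong (λ e → r * (e + pair nad i j) + r * (N * N)) (sym (pair-ad i j)) ⟩
          r * (pair ad i j + pair nad i j) + r * (N * N)
            ≡⟨ cong (λ e → r * e + r * (N * N)) (pair-ad+nad i j) ⟩
          r * (N * N) + r * (N * N)
            ≡⟨ shuffle₂ r₀ (N * N) (r * (N * N)) ⟩
          N * N + (r₀ * (N * N) + r * (N * N))
            ≡⟨ cong (λ e → N * N + (r₀ * e + r * (N * N))) (cong₂ _*_ (sym (ω*size i)) (sym (ω*size j))) ⟩
          N * N + (r₀ * (ω i * size G i * (ω j * size G j)) + r * (N * N))
            ≡⟨ cong (λ e → N * N + (e + r * (N * N))) (shuffle₃ r₀ (ω i) (ω j) (size G i) (size G j)) ⟩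
          N * N + (ω i * (ω j * (r₀ * (size G i * size G j))) + r * (N * N)) ∎)
      where
      open ≡-Reasoning
      shuffle₁ : ∀ r p a b e n → r * p + (a * (b * (r * e)) + r * n) + 0 ≡ r * (a * (b * e) + p) + r * n
      shuffle₁ = solve-∀
      shuffle₂ : ∀ r₀ n m → suc r₀ * n + m ≡ n + (r₀ * n + m)
      shuffle₂ = solve-∀
      shuffle₃ : ∀ r₀ a b s t → r₀ * (a * s * (b * t)) ≡ a * (b * (r₀ * (s * t)))
      shuffle₃ = solve-∀

    pair-nad≤ : ∀ i j → r * pair nad i j ≤ N * N + r * (N * N) * δ i j
    pair-nad≤ i j with i ≟ j
    ... | no i≢j   = ≤-trans (pair-density i≢j) (m≤m+n _ _)
    ... | yes refl = ≤-trans (*-monoʳ-≤ r (subst (pair nad i i ≤_) (pair-ad+nad i i) (m≤n+m _ (pair ad i i))))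
                             (≤-trans (≤-reflexive (sym (*-identityʳ _))) (m≤n+m _ (N * N)))

    bimass-δ : ∀ J → bimass parts (⟦_⟧ ∘ J) (⟦_⟧ ∘ J) δ ≤ ∥ J ∥
    bimass-δ J = ∑-mono parts (λ i → begin
      ⟦ J i ⟧ * ∑ parts (λ j → ⟦ J j ⟧ * δ i j) ≡⟨ cong (⟦ J i ⟧ *_) (trans (∑-cong parts (λ j → *-comm ⟦ J j ⟧ (δ i j))) (∑-δ ℓ (⟦_⟧ ∘ J) i)) ⟩
      ⟦ J i ⟧ * ⟦ J i ⟧                         ≤⟨ *-monoʳ-≤ ⟦ J i ⟧ (⟦⟧≤1 (J i)) ⟩
      ⟦ J i ⟧ * 1                               ≡⟨ *-identityʳ _ ⟩
      ⟦ J i ⟧                                   ∎)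
      where open ≤-Reasoning

    -- The last term pays for the diagonal pairs i = j, where only the trivial bound N² is
    -- available. It is linear in `∥ J ∥`, the main term quadratic.
    nad≤ : ∀ J → r * bimass vertices (weight J) (weight J) nad ≤ ∥ J ∥ * N * (∥ J ∥ * N) + r * (∥ J ∥ * (N * N))
    nad≤ J = begin
      r * bimass vertices (weight J) (weight J) nad ≡⟨ cong (r *_) (bimass-parts J nad) ⟩
      r * bimass parts j j (pair nad)               ≡⟨ sym (bimass-*ˡ parts j j r (pair nad)) ⟩
      bimass parts j j (λ i i′ → r * pair nad i i′)  ≤⟨ bimass-mono parts j j pair-nad≤ ⟩
      bimass parts j j (λ i i′ → N * N + r * (N * N) * δ i i′) ≡⟨ bimass-+ parts j j (λ _ _ → N * N) (λ i i′ → r * (N * N) * δ i i′) ⟩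
      bimass parts j j (λ i i′ → N * N) + bimass parts j j (λ i i′ → r * (N * N) * δ i i′)
        ≡⟨ cong₂ _+_ (bimass-× parts j j (λ _ → N) (λ _ → N)) (bimass-*ˡ parts j j (r * (N * N)) δ) ⟩
      mass parts j (λ _ → N) * mass parts j (λ _ → N) + r * (N * N) * bimass parts j j δ
        ≤⟨ +-mono-≤ (≤-reflexive (cong₂ _*_ const const)) (*-monoʳ-≤ (r * (N * N)) (bimass-δ J)) ⟩
      ∥ J ∥ * N * (∥ J ∥ * N) + r * (N * N) * ∥ J ∥
        ≡⟨ cong (∥ J ∥ * N * (∥ J ∥ * N) +_) (shuffle r (N * N) ∥ J ∥) ⟩
      ∥ J ∥ * N * (∥ J ∥ * N) + r * (∥ J ∥ * (N * N)) ∎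
      where
      open ≤-Reasoning
      j = ⟦_⟧ ∘ J
      const : mass parts j (λ _ → N) ≡ ∥ J ∥ * N
      const = trans (mass-cong parts j (λ _ → sym (*-identityˡ N)))
        (trans (mass-*ʳ parts j N (λ _ → 1)) (cong (_* N) (sym (∑-mass parts j))))
      shuffle : ∀ a b c → a * b * c ≡ a * (c * b)
      shuffle = solve-∀

-- Colour classes and their weights

mass-same : ∀ {r} (xs : List A) (ys : List B) X Y (c : A → Fin r) (c′ : B → Fin r) →
  mass xs X (λ u → mass ys Y (λ v → δ (c u) (c′ v))) ≡
  ∑ (allFin r) (λ s → mass xs X (λ u → δ (c u) s) * mass ys Y (λ v → δ (c′ v) s))
mass-same {r = r} xs ys X Y c c′ = begin
  mass xs X (λ u → mass ys Y (λ v → δ (c u) (c′ v)))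
    ≡⟨ mass-cong xs X (λ u → mass-cong ys Y (λ v → expand (c u) (c′ v))) ⟩
  mass xs X (λ u → mass ys Y (λ v → ∑ (allFin r) (λ s → δ (c u) s * δ (c′ v) s)))
    ≡⟨ mass-cong xs X (λ u → mass-∑ ys (allFin r) Y (λ v s → δ (c u) s * δ (c′ v) s)) ⟩
  mass xs X (λ u → ∑ (allFin r) (λ s → mass ys Y (λ v → δ (c u) s * δ (c′ v) s)))
    ≡⟨ mass-∑ xs (allFin r) X (λ u s → mass ys Y (λ v → δ (c u) s * δ (c′ v) s)) ⟩
  ∑ (allFin r) (λ s → mass xs X (λ u → mass ys Y (λ v → δ (c u) s * δ (c′ v) s)))
    ≡⟨ ∑-cong (allFin r) (λ s → trans
         (mass-cong xs X (λ u → mass-*ˡ ys Y (δ (c u) s) (λ v → δ (c′ v) s)))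
         (mass-*ʳ xs X (mass ys Y (λ v → δ (c′ v) s)) (λ u → δ (c u) s))) ⟩
  ∑ (allFin r) (λ s → mass xs X (λ u → δ (c u) s) * mass ys Y (λ v → δ (c′ v) s)) ∎
  where
  open ≡-Reasoning
  expand : ∀ i j → δ i j ≡ ∑ (allFin r) (λ s → δ i s * δ j s)
  expand i j = trans (δ-sym i j) (sym (∑-δ r (δ j) i))

mass-classes : ∀ {r} (xs : List A) X (c : A → Fin r) →
  ∑ (allFin r) (λ s → mass xs X (λ u → δ (c u) s)) ≡ mass xs X (λ _ → 1)
mass-classes {r = r} xs X c = trans (sym (mass-∑ xs (allFin r) X (λ u s → δ (c u) s)))
  (mass-cong xs X (λ u → trans (∑-cong (allFin r) (λ s → sym (*-identityʳ (δ (c u) s)))) (∑-δ r (λ _ → 1) (c u))))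

strict-rearrangement : ∀ {m m′ n n′} → m < m′ → n < n′ → m * n′ + m′ * n < m * n + m′ * n′
strict-rearrangement {m} {m′} {n} {n′} m< n< =
  subst₂ (λ x y → m * y + x * n < m * n + x * y) (m+[n∸m]≡n m<) (m+[n∸m]≡n n<)
    (linear {0} {0} (a + b + a * b) z≤n (shuffle m a n b))
  where
  a = m′ ∸ suc m
  b = n′ ∸ suc n
  shuffle : ∀ m a n b → suc (m * (suc n + b) + (suc m + a) * n) + 0 + (a + b + a * b) ≡
            m * n + (suc m + a) * (suc n + b) + 0
  shuffle = solve-∀

-- Colourings of a dense graph without the clique

module Core {ℓ} r₀ (G : PartiteGraph ℓ) (density : DensityCondition (suc (suc r₀)) G)
  (noClique : ¬ Cliques.Clique (adj G) (λ _ → ⊤) (suc (suc r₀))) where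

  open Parts G public
  open Density {r₀} density public

  -- Non-adjacent pairs of equal colour, together with the monochromatic edges, are all pairs of
  -- equal colour. Summed up, this ties the density (`nad`), the quality of the colouring (`mono`,
  -- `miss`) and the class weights (`δ`) together.
  nad+mono : ∀ {q} (c : V → Fin q) u v → nad u v + mono c u v ≡ miss c u v + δ (c u) (c v)
  nad+mono c u v = cases (adj G u v) (does (c u ≟ c v))
    where
    cases : ∀ a d → ⟦ not a ⟧ + ⟦ a ⟧ * ⟦ d ⟧ ≡ ⟦ not a ⟧ * ⟦ not d ⟧ + ⟦ d ⟧
    cases true  true  = refl
    cases true  false = refl
    cases false true  = refl
    cases false false = refl

  module Classes (J : Fin ℓ → Bool) (c : V → Fin r) κ
    (few : bimass vertices (weight J) (weight J) (mono c) ≤ κ * (∥ J ∥ * (N * N))) where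

    private
      M = ∥ J ∥
      T = M * N
      U = M * (N * N)
      X = weight J
      F = allFin r

    cls : Fin r → ℕ
    cls t = mass vertices X (λ v → δ (c v) t)

    private
      same Z m x : ℕ
      same = ∑ F (λ s → cls s * cls s)
      Z = bimass vertices X X nad
      m = bimass vertices X X (mono c)
      x = bimass vertices X X (miss c)

      D : Fin r → ℕ
      D s = ∣ r * cls s - T ∣ * ∣ r * cls s - T ∣

      balance : Z + m ≡ x + same
      balance = begin
        Z + m ≡⟨ sym (bimass-+ vertices X X nad (mono c)) ⟩
        bimass vertices X X (λ u v → nad u v + mono c u v) ≡⟨ bimass-cong vertices X X (nad+mono c) ⟩
        bimass vertices X X (λ u v → miss c u v + δ (c u) (c v)) ≡⟨ bimass-+ vertices X X (miss c) (λ u v → δ (c u) (c v)) ⟩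
        x + bimass vertices X X (λ u v → δ (c u) (c v)) ≡⟨ cong (x +_) (mass-same vertices vertices X X c c) ⟩
        x + same ∎
        where open ≡-Reasoning

      variance : r * r * same ≡ r * (T * T) + ∑ F D
      variance = subst (λ S → r * r * same ≡ r * (S * S) + ∑ F (λ s → ∣ r * cls s - S ∣ * ∣ r * cls s - S ∣))
        (trans (mass-classes vertices X c) (total J)) (∑-variance r cls)

      cauchy : T * T ≤ r * same
      cauchy = *-cancelˡ-≤ r (≤-trans (m≤m+n _ (∑ F D))
        (≤-reflexive (trans (sym variance) (*-assoc r r same))))

    -- In `balance`, r * Z is at most T² + r * U by density and r * same is at least T² by
    -- Cauchy-Schwarz. The squares cancel and only terms of order U remain.
    miss-bound : bimass vertices X X (miss c) ≤ suc κ * U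
    miss-bound = *-cancelˡ-≤ r (linear 0
      (+-mono-≤ (+-mono-≤ (nad≤ J) cauchy) (+-mono-≤ (*-monoʳ-≤ r few) (*-monoʳ-≤ r (≤-reflexive (sym balance)))))
      (shuffle r T U κ x same Z m))
      where
      shuffle : ∀ r T U κ x e Z m → r * x + (T * T + r * U + r * e + (r * (κ * U) + r * (Z + m))) + 0 ≡
                r * (suc κ * U) + (r * Z + T * T + (r * m + r * (x + e)))
      shuffle = solve-∀

    deviation : ∑ F D ≤ r * r * (suc κ * U)
    deviation = linear (r * r * x)
      (+-mono-≤ (+-mono-≤ (*-monoʳ-≤ r (nad≤ J)) (*-monoʳ-≤ (r * r) few))
        (+-mono-≤ (*-monoʳ-≤ (r * r) (≤-reflexive (sym balance))) (≤-reflexive (sym variance))))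
      (shuffle r T U κ x same Z m (∑ F D))
      where
      shuffle : ∀ r T U κ x e Z m d →
        d + (r * (T * T + r * U) + r * r * (κ * U) + (r * r * (Z + m) + r * r * e)) + r * r * x ≡
        r * r * (suc κ * U) + (r * (r * Z) + r * r * m + (r * r * (x + e) + (r * (T * T) + d)))
      shuffle = solve-∀

    -- A class below half of the average T / r would by itself have squared deviation above T² / 4,
    -- whereas the total deviation is of order U = T² / M.
    class-large : 4 * (r * r) * suc κ ≤ M → ∀ t → T ≤ 2 * (r * cls t)
    class-large large t with T ≤? 2 * (r * cls t)
    ... | yes p = p
    ... | no ¬p = contradiction (begin-strict
      T * T                        <⟨ *-mono-< T<2e T<2e ⟩
      2 * e * (2 * e)              ≡⟨ shuffle₁ e ⟩
      4 * D t                      ≤⟨ *-monoʳ-≤ 4 (≤-trans (∑-∈ D (∈-allFin t)) deviation) ⟩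
      4 * (r * r * (suc κ * U))    ≡⟨ shuffle₂ r (suc κ) U ⟩
      4 * (r * r) * suc κ * U      ≤⟨ *-monoˡ-≤ U large ⟩
      M * U                        ≡⟨ shuffle₃ M N ⟩
      T * T                        ∎) (<-irrefl refl)
      where
      open ≤-Reasoning
      e = ∣ r * cls t - T ∣
      T<2e : T < 2 * e
      T<2e = linear 0 (+-mono-≤ (≰⇒> ¬p) (*-monoʳ-≤ 2 (m≤n+∣n-m∣ T (r * cls t)))) (shuffle T (r * cls t) e)
        where
        shuffle : ∀ T n e → suc T + (T + 2 * (n + e)) + 0 ≡ 2 * e + (suc (2 * n) + 2 * T)
        shuffle = solve-∀
      shuffle₁ : ∀ e → 2 * e * (2 * e) ≡ 4 * (e * e)
      shuffle₁ = solve-∀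
      shuffle₂ : ∀ r κ U → 4 * (r * r * (κ * U)) ≡ 4 * (r * r) * κ * U
      shuffle₂ = solve-∀
      shuffle₃ : ∀ M N → M * (M * (N * N)) ≡ M * N * (M * N)
      shuffle₃ = solve-∀

  ad² : V → V → V → ℕ
  ad² u v x = ⟦ adj G u x ∧ adj G v x ⟧

  -- Otherwise the common neighbourhood would contain a clique with one vertex of
  -- each colour other than s.
  some-class-thin : ∀ J (c : V → Fin r) κ →
    bimass vertices (weight J) (weight J) (miss c) ≤ κ * (∥ J ∥ * (N * N)) →
    16 * (r * r * (r * r)) * κ ≤ ∥ J ∥ →
    ∀ u v → adj G u v ≡ true → ∀ s →
    ∃[ t ] t ≢ s × 4 * r * mass vertices (weight J) (λ x → δ (c x) t * ad² u v x) ≤ ∥ J ∥ * N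
  some-class-thin J c κ few large u v uv s
    with any? (λ a → 4 * r * mass vertices (weight J) (λ x → δ (c x) (punchIn s a) * ad² u v x) ≤? ∥ J ∥ * N)
  ... | yes (a , le) = punchIn s a , punchInᵢ≢i s a , le
  ... | no ¬∃ = ⊥-elim (noClique (extend (symm G) u tt (restrict (symm G) (λ _ → tt) withV) (Clique.inside withV)))
    where
    M = ∥ J ∥
    E = bimass vertices (weight J) (weight J) (miss c)
    sparse : 4 * r * (4 * r) * (r₀ * r₀ * E) ≤ M * N * (M * N)
    sparse = begin
      4 * r * (4 * r) * (r₀ * r₀ * E)            ≤⟨ *-monoʳ-≤ (4 * r * (4 * r)) (*-mono-≤ (*-mono-≤ (n≤1+n r₀) (n≤1+n r₀)) few) ⟩
      4 * r * (4 * r) * (r * r * (κ * (M * (N * N)))) ≡⟨ shuffle₁ r κ (M * (N * N)) ⟩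
      16 * (r * r * (r * r)) * κ * (M * (N * N)) ≤⟨ *-monoˡ-≤ (M * (N * N)) large ⟩
      M * (M * (N * N))                          ≡⟨ shuffle₂ M N ⟩
      M * N * (M * N)                            ∎
      where
      open ≤-Reasoning
      shuffle₁ : ∀ r κ U → 4 * r * (4 * r) * (r * r * (κ * U)) ≡ 16 * (r * r * (r * r)) * κ * U
      shuffle₁ = solve-∀
      shuffle₂ : ∀ M N → M * (M * (N * N)) ≡ M * N * (M * N)
      shuffle₂ = solve-∀
    common : Clique (λ x → adj G u x ∧ adj G v x ≡ true) r₀
    common = rainbow-clique c (weight J) r₀ (punchIn s) (λ {a} {b} → punchIn-injective s a b)
      (λ x → adj G u x ∧ adj G v x) (4 * r) (M * N) sparse (λ a → ≰⇒> (λ le → ¬∃ (a , le)))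
    split : ∀ {a b} → a ∧ b ≡ true → a ≡ true × b ≡ true
    split {true} e = refl , e
    withV : Clique (λ x → adj G u x ≡ true) (suc r₀)
    withV = extend (symm G) v uv (restrict (symm G) (proj₁ ∘ split) common) (λ a → proj₂ (split (Clique.inside common a)))

  everything : Fin ℓ → Bool
  everything _ = true

  weight≤ : ∀ J v → weight J v ≤ weight everything v
  weight≤ J v = *-monoˡ-≤ (ω (proj₁ v)) (⟦⟧≤1 (J (proj₁ v)))

  own-part : ∀ J i → mass vertices (weight J) (λ x → δ i (proj₁ x)) ≤ N
  own-part J i = begin
    mass vertices (weight J) (λ x → δ i (proj₁ x))            ≡⟨ mass-parts J (λ x → δ i (proj₁ x)) ⟩
    mass parts (⟦_⟧ ∘ J) (λ j → part j (λ _ → δ i j)) ≡⟨ mass-cong parts (⟦_⟧ ∘ J) (λ j → part-const j (δ i j)) ⟩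
    mass parts (⟦_⟧ ∘ J) (λ j → δ i j * N)           ≤⟨ ∑-mono parts (λ j → *-monoˡ-≤ (δ i j * N) (⟦⟧≤1 (J j))) ⟩
    ∑ parts (λ j → 1 * (δ i j * N))                  ≡⟨ ∑-cong parts (λ j → *-identityˡ (δ i j * N)) ⟩
    ∑ parts (λ j → δ i j * N)                        ≡⟨ ∑-δ ℓ (λ _ → N) i ⟩
    N                                                ∎
    where open ≤-Reasoning

  mass-monoᴶ : ∀ J {φ ψ : V → ℕ} → (∀ x → J (proj₁ x) ≡ true → φ x ≤ ψ x) →
               mass vertices (weight J) φ ≤ mass vertices (weight J) ψ
  mass-monoᴶ J {φ} {ψ} h = ∑-mono vertices pointwise
    where
    pointwise : ∀ x → ⟦ J (proj₁ x) ⟧ * ω (proj₁ x) * φ x ≤ ⟦ J (proj₁ x) ⟧ * ω (proj₁ x) * ψ x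
    pointwise x with J (proj₁ x) in jx
    ... | true  = *-monoʳ-≤ (1 * ω (proj₁ x)) (h x jx)
    ... | false = z≤n

  mass-vanishing : ∀ J φ → mass vertices (weight J) φ ≡ 0 → ∀ x → J (proj₁ x) ≡ true → φ x ≡ 0
  mass-vanishing J φ e x jx = n≤0⇒n≡0 (≮⇒≥ λ pos → <-irrefl refl (<-≤-trans
    (*-pos (subst (0 <_) (sym (trans (cong (λ y → ⟦ y ⟧ * ω (proj₁ x)) jx) (+-identityʳ _))) (0<ω (proj₁ x))) pos)
    (subst (weight J x * φ x ≤_) e (∑-∈ (λ y → weight J y * φ y) (vertices-complete x)))))

  population : (V → Fin r) → Fin ℓ → Fin r → ℕ
  population b i s = part i (λ v → δ (b v) s)

  ∑-population : ∀ b i → ∑ (allFin r) (population b i) ≡ N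
  ∑-population b i = trans (mass-classes (allFin (size G i)) (λ _ → ω i) (λ a → b (i , a)))
    (trans (part-const i 1) (*-identityˡ N))

  pair-balance : ∀ b i j → pair nad i j + pair (mono b) i j ≡
                 pair (miss b) i j + ∑ (allFin r) (λ s → population b i s * population b j s)
  pair-balance b i j = begin
    pair nad i j + pair (mono b) i j                  ≡⟨ sym (pair-+ nad (mono b) i j) ⟩
    pair (λ u v → nad u v + mono b u v) i j           ≡⟨ pair-cong i j (nad+mono b) ⟩
    pair (λ u v → miss b u v + δ (b u) (b v)) i j     ≡⟨ pair-+ (miss b) (λ u v → δ (b u) (b v)) i j ⟩
    pair (miss b) i j + pair (λ u v → δ (b u) (b v)) i j
      ≡⟨ cong (pair (miss b) i j +_) (mass-same (allFin (size G i)) (allFin (size G j))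
           (λ _ → ω i) (λ _ → ω j) (λ a → b (i , a)) (λ a → b (j , a))) ⟩
    pair (miss b) i j + ∑ (allFin r) (λ s → population b i s * population b j s) ∎
    where open ≡-Reasoning

-- Recolouring each vertex by a class in which it has few neighbours

module Recolouring {ℓ} r₀ (G : PartiteGraph ℓ) (density : DensityCondition (suc (suc r₀)) G)
  (noClique : ¬ Cliques.Clique (adj G) (λ _ → ⊤) (suc (suc r₀)))
  (Q : ℕ) (0<Q : 0 < Q)
  (large₁ : 8 * (suc r₀ * suc r₀) ≤ ℓ)
  (large₂ : 2 * (suc r₀ * suc r₀) * (64 * suc r₀ * Q * (64 * suc r₀ * Q)) ≤ ℓ) where

  open Core r₀ G density noClique public

  -- The factor Q keeps T / d small compared with the weight of J, which may hold only a 1/Q share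
  -- of the parts; 64 * r is what `monodeg-arithmetic` requires.
  L d : ℕ
  L = ∥ everything ∥
  d = 64 * r * Q

  private
    T = L * N
    U = L * (N * N)
    X = weight everything

  L≡ℓ : L ≡ ℓ
  L≡ℓ = trans (∑-const ℓ 1) (*-identityʳ ℓ)

  private
    stable : Σ (V → Fin r) λ c → ∑ vertices X * ∑ vertices X + r * bimass vertices X X (mono c) ≤ r * bimass vertices X X nad
    stable with stability r₀ X
    ... | inj₁ K = contradiction (restrict (symm G) (λ _ → tt) K) noClique
    ... | inj₂ s = s

  c : V → Fin r
  c = proj₁ stable

  -- Stability gives T² + r * mono ≤ r * nad and density gives r * nad ≤ T² + r * U, so T² cancels.
  few : bimass vertices X X (mono c) ≤ 1 * U
  few = *-cancelˡ-≤ r (linear 0 (+-mono-≤ (proj₂ stable) (nad≤ everything))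
    (trans (shuffle r (bimass vertices X X (mono c)) (bimass vertices X X nad) T U)
      (cong (λ S → r * (1 * U) + (S * S + r * bimass vertices X X (mono c) + r * bimass vertices X X nad))
        (trans (sym (total everything)) (sym (∑-mass vertices X))))))
    where
    shuffle : ∀ r m Z T U → r * m + (r * Z + (T * T + r * U)) + 0 ≡ r * (1 * U) + (T * T + r * m + r * Z)
    shuffle = solve-∀

  open Classes everything c 1 few

  private
    0<T : 0 < T
    0<T = *-pos (≤-trans (s≤s z≤n) (≤-trans large₁ (≤-reflexive (sym L≡ℓ)))) 0<N

    T≤cls : ∀ t → T ≤ 2 * (r * cls t)
    T≤cls = class-large (≤-trans (≤-trans (≤-reflexive (shuffle (r * r))) large₁) (≤-reflexive (sym L≡ℓ)))
      where
      shuffle : ∀ x → 4 * x * 2 ≡ 8 * x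
      shuffle = solve-∀

  toward : V → Fin r → ℕ
  toward v s = mass vertices X (λ x → δ (c x) s * ad v x)

  private
    -- If v had neighbours of weight above T / d in every class, the scarcity of missing edges would
    -- give a rainbow clique on r vertices in its neighbourhood, and v would complete it to the
    -- forbidden one.
    recolour : ∀ v → ∃[ s ] d * toward v s ≤ T
    recolour v with any? (λ s → d * toward v s ≤? T)
    ... | yes p = p
    ... | no ¬∃ = contradiction
      (extend (symm G) v tt (restrict (symm G) (λ _ → tt) K) (Clique.inside K)) noClique
      where
      E = bimass vertices X X (miss c)
      sparse : d * d * (r * r * E) ≤ T * T
      sparse = begin
        d * d * (r * r * E)       ≤⟨ *-monoʳ-≤ (d * d) (*-monoʳ-≤ (r * r) miss-bound) ⟩
        d * d * (r * r * (2 * U)) ≡⟨ shuffle₁ d r U ⟩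
        2 * (r * r) * (d * d) * U ≤⟨ *-monoˡ-≤ U (≤-trans large₂ (≤-reflexive (sym L≡ℓ))) ⟩
        L * U                     ≡⟨ shuffle₂ L N ⟩
        T * T                     ∎
        where
        open ≤-Reasoning
        shuffle₁ : ∀ d r U → d * d * (r * r * (2 * U)) ≡ 2 * (r * r) * (d * d) * U
        shuffle₁ = solve-∀
        shuffle₂ : ∀ M N → M * (M * (N * N)) ≡ M * N * (M * N)
        shuffle₂ = solve-∀
      K : Clique (λ x → adj G v x ≡ true) r
      K = rainbow-clique c X r (λ s → s) (λ e → e) (adj G v) d T sparse (λ s → ≰⇒> (λ le → ¬∃ (s , le)))

  b : V → Fin r
  b v = proj₁ (recolour v)

  toward-b : ∀ v → d * toward v (b v) ≤ T
  toward-b v = proj₂ (recolour v)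

  -- If b u and c u differ, the class b u has weight at least T / (2r), but at most T / (4r) of it
  -- is adjacent to u; so u accounts for missing weight at least T / (4r), of which there is only 2U
  -- in total.
  disagreement : mass vertices X (λ u → δ̅ (b u) (c u)) ≤ 8 * r * N
  disagreement = *-cancelʳ-≤ _ _ T {{>-nonZero 0<T}} (begin
    mass vertices X (λ u → δ̅ (b u) (c u)) * T       ≡⟨ sym (mass-*ʳ vertices X T (λ u → δ̅ (b u) (c u))) ⟩
    mass vertices X (λ u → δ̅ (b u) (c u) * T)       ≤⟨ mass-mono vertices X pointwise ⟩
    mass vertices X (λ u → 4 * r * mass vertices X (miss c u)) ≡⟨ mass-*ˡ vertices X (4 * r) (λ u → mass vertices X (miss c u)) ⟩
    4 * r * bimass vertices X X (miss c)            ≤⟨ *-monoʳ-≤ (4 * r) miss-bound ⟩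
    4 * r * (2 * U)                                 ≡⟨ shuffle r L N ⟩
    8 * r * N * T                                   ∎)
    where
    open ≤-Reasoning
    shuffle : ∀ r L N → 4 * r * (2 * (L * (N * N))) ≡ 8 * r * N * (L * N)
    shuffle = solve-∀
    4r≤d : 4 * r ≤ d
    4r≤d = begin
      4 * r           ≡⟨ sym (*-identityʳ (4 * r)) ⟩
      4 * r * 1       ≤⟨ *-monoʳ-≤ (4 * r) (≤-trans 0<Q (m≤n*m Q 16)) ⟩
      4 * r * (16 * Q) ≡⟨ ring r Q ⟩
      d               ∎
      where
      ring : ∀ r Q → 4 * r * (16 * Q) ≡ 64 * r * Q
      ring = solve-∀
    far : ∀ u → b u ≢ c u → T ≤ 4 * r * mass vertices X (miss c u)
    far u b≢c = linear 0
      (+-mono-≤ (+-mono-≤ (*-monoʳ-≤ 2 (T≤cls (b u)))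
                          (*-monoʳ-≤ (4 * r) (mass-≤+ vertices X (λ x → δ (c x) (b u) * ad u x) (miss c u) split)))
                (≤-trans (*-monoˡ-≤ (toward u (b u)) 4r≤d) (toward-b u)))
      (ring T r (cls (b u)) (toward u (b u)) (mass vertices X (miss c u)))
      where
      ring : ∀ T r n t m → T + (2 * (2 * (r * n)) + 4 * r * (t + m) + T) + 0 ≡
             4 * r * m + (2 * T + 4 * r * n + 4 * r * t)
      ring = solve-∀
      split : ∀ x → δ (c x) (b u) ≤ δ (c x) (b u) * ad u x + miss c u x
      split x with c x ≟ b u
      ... | no _  = z≤n
      ... | yes p = subst (λ e → 1 ≤ 1 * ad u x + nad u x * e)
        (sym (δ̅-≢ (λ q → b≢c (sym (trans q p)))))
        (≤-reflexive (trans (sym (ad+nad u x)) (ring′ (ad u x) (nad u x))))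
        where
        ring′ : ∀ a n → a + n ≡ 1 * a + n * 1
        ring′ = solve-∀
    pointwise : ∀ u → δ̅ (b u) (c u) * T ≤ 4 * r * mass vertices X (miss c u)
    pointwise u with b u ≟ c u
    ... | yes _  = z≤n
    ... | no b≢c = subst (_≤ 4 * r * mass vertices X (miss c u)) (sym (+-identityʳ T)) (far u b≢c)

-- No monochromatic and no missing edges inside J

144r²≤512r² : ∀ r → 1 ≤ r → 128 * (r * r) + 16 * r ≤ 512 * (r * r)
144r²≤512r² r 1≤r = linear (368 * (r * r)) (*-monoʳ-≤ (16 * r) 1≤r) (ring r)
  where
  ring : ∀ r → 128 * (r * r) + 16 * r + 16 * r * r + 368 * (r * r) ≡ 512 * (r * r) + 16 * r * 1
  ring = solve-∀

-- For an edge uv and a class of weight n: k is the weight of its common neighbours, p and q are the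
-- weights missed by u and v, and m, m′ are their missing degrees for b. The bound on M absorbs the
-- errors from recoloured vertices and own parts.
mono-edge-arithmetic : ∀ r n k p q m m′ N M →
  M * N ≤ 2 * (r * n) → n ≤ k + p + q → 4 * r * k ≤ M * N →
  p ≤ m + 8 * r * N + N → q ≤ m′ + 8 * r * N + N → 128 * (r * r) + 16 * r ≤ M →
  M * N ≤ 8 * r * (m + m′)
mono-edge-arithmetic r n k p q m m′ N M h₁ h₂ h₃ h₄ h₅ h₆ = linear 0
  (+-mono-≤ (+-mono-≤ (+-mono-≤ (*-monoʳ-≤ 4 h₁) (*-monoʳ-≤ (8 * r) h₂))
            (+-mono-≤ (*-monoʳ-≤ 2 h₃) (*-monoʳ-≤ (8 * r) (+-mono-≤ h₄ h₅))))
            (*-monoˡ-≤ N h₆))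
  (ring r n k p q m m′ N M)
  where
  ring : ∀ r n k p q m m′ N M →
    M * N + (4 * (2 * (r * n)) + 8 * r * (k + p + q) +
             (2 * (M * N) + 8 * r * (m + 8 * r * N + N + (m′ + 8 * r * N + N))) + M * N) + 0 ≡
    8 * r * (m + m′) + (4 * (M * N) + 8 * r * n + (2 * (4 * r * k) + 8 * r * (p + q)) +
             (128 * (r * r) + 16 * r) * N)
  ring = solve-∀

monodeg-arithmetic : ∀ r g t e N M →
  g ≤ t + e → e ≤ 8 * r * N → 64 * r * t ≤ M * N → 512 * (r * r) ≤ M → 32 * r * g ≤ M * N
monodeg-arithmetic r g t e N M h₁ h₂ h₃ h₄ = *-cancelˡ-≤ 2 (linear 0
  (+-mono-≤ (+-mono-≤ (*-monoʳ-≤ (64 * r) h₁) (*-monoʳ-≤ (64 * r) h₂)) (+-mono-≤ h₃ (*-monoˡ-≤ N h₄)))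
  (ring r g t e N M))
  where
  ring : ∀ r g t e N M → 2 * (32 * r * g) + (64 * r * (t + e) + 64 * r * (8 * r * N) + (M * N + M * N)) + 0 ≡
         2 * (M * N) + (64 * r * g + 64 * r * e + (64 * r * t + 512 * (r * r) * N))
  ring = solve-∀

module _ {ℓ} r₀ (G : PartiteGraph ℓ) (density : DensityCondition (suc (suc r₀)) G)
  (noClique : ¬ Cliques.Clique (adj G) (λ _ → ⊤) (suc (suc r₀))) where

  open Core r₀ G density noClique

  -- c is the colouring with few monochromatic edges, b the recolouring derived from it.
  module Exact
    (Q : ℕ) (0<Q : 0 < Q) (c b : Vertex G → Fin (suc r₀))
    (few : bimass vertices (weight everything) (weight everything) (mono c) ≤ 1 * (∥ everything ∥ * (N * N)))
    (toward-b : ∀ v → 64 * r * Q * mass vertices (weight everything) (λ x → δ (c x) (b v) * ad v x) ≤ ∥ everything ∥ * N)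
    (disagreement : mass vertices (weight everything) (λ u → δ̅ (b u) (c u)) ≤ 8 * r * N)
    (J : Fin ℓ → Bool) (L≤QM : ∥ everything ∥ ≤ Q * ∥ J ∥)
    (M-large : 512 * (r * r * (r * r)) * suc Q ≤ ∥ J ∥)
    where

    private
      X = weight everything
      L = ∥ everything ∥
      d = 64 * r * Q
      toward : V → Fin r → ℕ
      toward v s = mass vertices X (λ x → δ (c x) s * ad v x)

    M : ℕ
    M = ∥ J ∥

    private
      Tᴶ = M * N
      Uᴶ = M * (N * N)
      Y = weight J

      ≤M : ∀ {x} k → x + k ≡ 512 * (r * r * (r * r)) * suc Q → x ≤ M
      ≤M {x} k e = ≤-trans (m≤m+n x k) (≤-trans (≤-reflexive e) M-large)

      few′ : bimass vertices Y Y (mono c) ≤ Q * Uᴶ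
      few′ = begin
        bimass vertices Y Y (mono c) ≤⟨ bimass-monoˡ vertices (mono c) (weight≤ J) (weight≤ J) ⟩
        bimass vertices X X (mono c) ≤⟨ few ⟩
        1 * (L * (N * N))            ≡⟨ *-identityˡ _ ⟩
        L * (N * N)                  ≤⟨ *-monoˡ-≤ (N * N) L≤QM ⟩
        Q * M * (N * N)              ≡⟨ *-assoc Q M (N * N) ⟩
        Q * Uᴶ                       ∎
        where open ≤-Reasoning

      module C = Classes J c Q few′

      T≤clsᴶ : ∀ t → Tᴶ ≤ 2 * (r * C.cls t)
      T≤clsᴶ = C.class-large (≤M (4 * (r * r) * suc Q * (128 * (r₀ * r₀ + 2 * r₀) + 127)) (ring r₀ Q))
        where
        ring : ∀ r₀ Q → 4 * (suc r₀ * suc r₀) * suc Q + 4 * (suc r₀ * suc r₀) * suc Q * (128 * (r₀ * r₀ + 2 * r₀) + 127)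
                        ≡ 512 * (suc r₀ * suc r₀ * (suc r₀ * suc r₀)) * suc Q
        ring = solve-∀

    512r²≤M : 512 * (r * r) ≤ M
    -- The slack uses r² - 1 = r₀² + 2 r₀, so that no subtraction occurs.
    512r²≤M = ≤M (512 * (r * r) * (r * r * Q + r₀ * r₀ + 2 * r₀)) (ring r₀ Q)
      where
      ring : ∀ r₀ Q → 512 * (suc r₀ * suc r₀) + 512 * (suc r₀ * suc r₀) * (suc r₀ * suc r₀ * Q + r₀ * r₀ + 2 * r₀)
                      ≡ 512 * (suc r₀ * suc r₀ * (suc r₀ * suc r₀)) * suc Q
      ring = solve-∀

    16r⁴κ≤M : ∀ {κ} → κ ≤ suc Q → 16 * (r * r * (r * r)) * κ ≤ M
    16r⁴κ≤M κ≤ = ≤-trans (*-mono-≤ (*-monoˡ-≤ (r * r * (r * r)) (m≤m+n 16 496)) κ≤) M-large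

    -- Inside a part there are no edges, so missing pairs there would have no monochromatic edges to
    -- be compared with in `miss≤mono`.
    missᵖ : V → V → ℕ
    missᵖ u v = miss b u v * δ̅ (proj₁ u) (proj₁ v)

    private
      md monodeg : V → ℕ
      md u = mass vertices Y (missᵖ u)
      monodeg u = mass vertices Y (mono b u)

      disagreementᴶ : mass vertices Y (λ u → δ̅ (b u) (c u)) ≤ 8 * r * N
      disagreementᴶ = ≤-trans (mass-monoˡ vertices (λ u → δ̅ (b u) (c u)) (weight≤ J)) disagreement

      away : V → Fin r → ℕ
      away y t = mass vertices Y (λ x → δ (c x) t * nad y x)

      -- Passes from the classes of c to those of b: the errors are the recoloured vertices, 8 * r *
      -- N, and the part of y itself, N.
      away≤md : ∀ y t → b y ≢ t → away y t ≤ md y + 8 * r * N + N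
      away≤md y t b≢t = ≤-trans
        (mass-≤++ vertices Y (missᵖ y) (λ x → δ̅ (b x) (c x)) (λ x → δ (proj₁ y) (proj₁ x)) pointwise)
        (+-mono-≤ (+-monoʳ-≤ (md y) disagreementᴶ) (own-part J (proj₁ y)))
        where
        pointwise : ∀ x → δ (c x) t * nad y x ≤ missᵖ y x + δ̅ (b x) (c x) + δ (proj₁ y) (proj₁ x)
        pointwise x with c x ≟ t
        ... | no _ = z≤n
        ... | yes c≡t with b x ≟ c x
        ...   | no _ = ≤-trans (*-monoʳ-≤ 1 (⟦⟧≤1 (not (adj G y x)))) (≤-trans (m≤n+m 1 (missᵖ y x)) (m≤m+n (missᵖ y x + 1) _))
        ...   | yes b≡c with proj₁ y ≟ proj₁ x
        ...     | yes _ = ≤-trans (*-monoʳ-≤ 1 (⟦⟧≤1 (not (adj G y x)))) (m≤n+m 1 _)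
        ...     | no _ = ≤-reflexive (subst (λ e → 1 * nad y x ≡ nad y x * e * 1 + 0 + 0)
          (sym (δ̅-≢ (λ q → b≢t (trans q (trans b≡c c≡t))))) (ring (nad y x)))
          where
          ring : ∀ n → 1 * n ≡ n * 1 * 1 + 0 + 0
          ring = solve-∀

      -- Some c-class t other than the common colour of u and v has few common neighbours of theirs.
      -- Its weight is at least T / (2r), so u or v misses much of it, and almost all of these
      -- misses join different b-colours.
      mono-edge : ∀ u v → adj G u v ≡ true → b u ≡ b v → Tᴶ ≤ 8 * r * (md u + md v)
      mono-edge u v uv bu≡bv = from (some-class-thin J c (suc Q) C.miss-bound (16r⁴κ≤M ≤-refl) u v uv (b u))
        where
        from : (∃[ t ] t ≢ b u × 4 * r * mass vertices Y (λ x → δ (c x) t * ad² u v x) ≤ Tᴶ) → Tᴶ ≤ 8 * r * (md u + md v)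
        from (t , t≢bu , thin) = mono-edge-arithmetic r (C.cls t) common (away u t) (away v t) (md u) (md v) N M
          (T≤clsᴶ t) cover thin (away≤md u t (t≢bu ∘ sym)) (away≤md v t (λ e → t≢bu (trans (sym e) (sym bu≡bv))))
          (≤-trans (144r²≤512r² r (s≤s z≤n)) 512r²≤M)
          where
          common = mass vertices Y (λ x → δ (c x) t * ad² u v x)
          cover : C.cls t ≤ common + away u t + away v t
          cover = mass-≤++ vertices Y (λ x → δ (c x) t * ad² u v x) (λ x → δ (c x) t * nad u x) (λ x → δ (c x) t * nad v x)
            (λ x → cases (adj G u x) (adj G v x) (δ (c x) t))
            where
            cases : ∀ p q k → k ≤ k * ⟦ p ∧ q ⟧ + k * ⟦ not p ⟧ + k * ⟦ not q ⟧
            cases true  true  k = ≤-trans (≤-reflexive (sym (*-identityʳ k))) (≤-trans (m≤m+n (k * 1) (k * 0)) (m≤m+n _ (k * 0)))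
            cases true  false k = ≤-trans (≤-reflexive (sym (*-identityʳ k))) (m≤n+m (k * 1) _)
            cases false q     k = ≤-trans (≤-reflexive (sym (*-identityʳ k))) (≤-trans (m≤n+m (k * 1) (k * 0)) (m≤m+n _ (k * ⟦ not q ⟧)))

      -- Here the recolouring pays off: a neighbour with the b-colour of u either lies in the
      -- c-class b u, where `toward-b` leaves few neighbours, or was itself recoloured. The constant
      -- is four times the 8 * r of `mono-edge`: one factor 2 for the two ends, another to beat
      -- `miss≤mono`.
      monodeg-small : ∀ u → 32 * r * monodeg u ≤ Tᴶ
      monodeg-small u = monodeg-arithmetic r (monodeg u) towardᴶ (mass vertices Y (λ x → δ̅ (b x) (c x))) N M
        split disagreementᴶ near 512r²≤M
        where
        towardᴶ = mass vertices Y (λ x → δ (c x) (b u) * ad u x)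
        near : 64 * r * towardᴶ ≤ Tᴶ
        near = *-cancelˡ-≤ Q {{>-nonZero 0<Q}} (begin
          Q * (64 * r * towardᴶ) ≡⟨ shuffle Q r towardᴶ ⟩
          d * towardᴶ            ≤⟨ *-monoʳ-≤ d (mass-monoˡ vertices (λ x → δ (c x) (b u) * ad u x) (weight≤ J)) ⟩
          d * toward u (b u)     ≤⟨ toward-b u ⟩
          L * N                  ≤⟨ *-monoˡ-≤ N L≤QM ⟩
          Q * M * N              ≡⟨ *-assoc Q M N ⟩
          Q * Tᴶ                 ∎)
          where
          open ≤-Reasoning
          shuffle : ∀ Q r t → Q * (64 * r * t) ≡ 64 * r * Q * t
          shuffle = solve-∀
        split : monodeg u ≤ towardᴶ + mass vertices Y (λ x → δ̅ (b x) (c x))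
        split = mass-≤+ vertices Y (λ x → δ (c x) (b u) * ad u x) (λ x → δ̅ (b x) (c x)) pointwise
          where
          pointwise : ∀ x → mono b u x ≤ δ (c x) (b u) * ad u x + δ̅ (b x) (c x)
          pointwise x with b u ≟ b x
          ... | no _ = ≤-trans (≤-reflexive (*-zeroʳ (ad u x))) z≤n
          ... | yes bu≡bx with b x ≟ c x
          ...   | no _ = ≤-trans (*-monoˡ-≤ 1 (ad≤1 u x)) (m≤n+m 1 _)
          ...   | yes bx≡cx = subst (λ e → ad u x * 1 ≤ e * ad u x + 0)
            (sym (trans (cong (δ (c x)) (trans bu≡bx bx≡cx)) (δ-refl (c x)))) (≤-reflexive (ring₁ (ad u x)))
            where
            ring₁ : ∀ a → a * 1 ≡ 1 * a + 0
            ring₁ = solve-∀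

      monoᴶ missᴶ : ℕ
      monoᴶ = bimass vertices Y Y (mono b)
      missᴶ = bimass vertices Y Y missᵖ

      mono-sym : ∀ u v → mono b u v ≡ mono b v u
      mono-sym u v = cong₂ _*_ (cong ⟦_⟧ (symm G u v)) (δ-sym (b u) (b v))

      -- Charge each monochromatic edge to the missing edges at its two ends.
      2mono≤miss : 2 * monoᴶ ≤ missᴶ
      2mono≤miss = *-cancelʳ-≤ _ _ Tᴶ {{>-nonZero (*-pos (≤-trans (s≤s z≤n) 512r²≤M) 0<N)}} (begin
        2 * monoᴶ * Tᴶ ≡⟨ ring₁ monoᴶ Tᴶ ⟩
        2 * (Tᴶ * monoᴶ) ≡⟨ cong (2 *_) (sym (bimass-*ˡ vertices Y Y Tᴶ (mono b))) ⟩
        2 * bimass vertices Y Y (λ u v → Tᴶ * mono b u v) ≤⟨ *-monoʳ-≤ 2 (bimass-mono vertices Y Y charge) ⟩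
        2 * bimass vertices Y Y (λ u v → 8 * r * (K u v + K v u))
          ≡⟨ cong (2 *_) (trans (bimass-*ˡ vertices Y Y (8 * r) (λ u v → K u v + K v u)) (cong (8 * r *_)
               (trans (bimass-+ vertices Y Y K (λ u v → K v u))
                      (cong (bimass vertices Y Y K +_) (sym (mass-swap vertices vertices Y Y K)))))) ⟩
        2 * (8 * r * (bimass vertices Y Y K + bimass vertices Y Y K)) ≡⟨ ring₂ r (bimass vertices Y Y K) ⟩
        32 * r * bimass vertices Y Y K ≡⟨ sym (mass-*ˡ vertices Y (32 * r) (λ u → mass vertices Y (K u))) ⟩
        mass vertices Y (λ u → 32 * r * mass vertices Y (K u)) ≤⟨ mass-mono vertices Y bound ⟩
        mass vertices Y (λ u → md u * Tᴶ) ≡⟨ mass-*ʳ vertices Y Tᴶ md ⟩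
        missᴶ * Tᴶ ∎)
        where
        open ≤-Reasoning
        K : V → V → ℕ
        K u v = md u * mono b u v
        ring₁ : ∀ m T → 2 * m * T ≡ 2 * (T * m)
        ring₁ = solve-∀
        ring₂ : ∀ r k → 2 * (8 * r * (k + k)) ≡ 32 * r * k
        ring₂ = solve-∀
        charge : ∀ u v → Tᴶ * mono b u v ≤ 8 * r * (K u v + K v u)
        mono-cases : ∀ u v → mono b u v ≡ 0 ⊎ (mono b u v ≡ 1 × adj G u v ≡ true × b u ≡ b v)
        mono-cases u v with adj G u v | b u ≟ b v
        ... | false | _     = inj₁ refl
        ... | true  | no _  = inj₁ refl
        ... | true  | yes p = inj₂ (refl , refl , p)
        charge u v = from (mono-cases u v)
          where
          from : mono b u v ≡ 0 ⊎ (mono b u v ≡ 1 × adj G u v ≡ true × b u ≡ b v) → Tᴶ * mono b u v ≤ 8 * r * (K u v + K v u)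
          from (inj₁ e) = subst (_≤ 8 * r * (K u v + K v u)) (sym (trans (cong (Tᴶ *_) e) (*-zeroʳ Tᴶ))) z≤n
          from (inj₂ (e , uv , same)) = begin
            Tᴶ * mono b u v                ≡⟨ trans (cong (Tᴶ *_) e) (*-identityʳ Tᴶ) ⟩
            Tᴶ                             ≤⟨ mono-edge u v uv same ⟩
            8 * r * (md u + md v)          ≡⟨ cong (λ x → 8 * r * x) (sym (cong₂ _+_
              (trans (cong (md u *_) e) (*-identityʳ (md u)))
              (trans (cong (md v *_) (trans (mono-sym v u) e)) (*-identityʳ (md v))))) ⟩
            8 * r * (K u v + K v u)        ∎
        bound : ∀ u → 32 * r * mass vertices Y (K u) ≤ md u * Tᴶ
        bound u = begin
          32 * r * mass vertices Y (K u)   ≡⟨ cong (32 * r *_) (mass-*ˡ vertices Y (md u) (mono b u)) ⟩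
          32 * r * (md u * monodeg u)      ≡⟨ shuffle (32 * r) (md u) (monodeg u) ⟩
          md u * (32 * r * monodeg u)      ≤⟨ *-monoʳ-≤ (md u) (monodeg-small u) ⟩
          md u * Tᴶ                        ∎
          where
          shuffle : ∀ a b c → a * (b * c) ≡ b * (a * c)
          shuffle = solve-∀

    module Rigid (pattern-constant : ∀ s t i j → J i ≡ true → J j ≡ true →
        (population b i s ≤ᵇ population b i t) ≡ (population b j s ≤ᵇ population b j t)) where

      ≤-transfer : ∀ {i j} → J i ≡ true → J j ≡ true → ∀ {s t} →
                   population b i s ≤ population b i t → population b j s ≤ population b j t
      ≤-transfer {i} {j} ji jj {s} {t} le =
        ≤ᵇ⇒≤ (population b j s) (population b j t) (subst IsTrue (pattern-constant s t i j ji jj) (≤⇒≤ᵇ le))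

      same-order : ∀ {i j} → J i ≡ true → J j ≡ true → SameOrder (population b i) (population b j)
      same-order {i} ji jj s t with ≤-total (population b i s) (population b i t)
      ... | inj₁ le = inj₁ (le , ≤-transfer ji jj le)
      ... | inj₂ le = inj₂ (le , ≤-transfer ji jj le)

      -- In `pair-balance` the non-adjacent pairs weigh at most N² / r by density, and the pairs of
      -- equal colour at least N² / r by Chebyshev.
      pair-miss≤mono : ∀ {i j} → i ≢ j → J i ≡ true → J j ≡ true → pair (miss b) i j ≤ pair (mono b) i j
      pair-miss≤mono {i} {j} i≢j ji jj = linear 0 (+-mono-≤ nad≤same (≤-reflexive (sym (pair-balance b i j))))
        (ring (pair (miss b) i j) (pair (mono b) i j) (pair nad i j) (∑ (allFin r) (λ s → population b i s * population b j s)))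
        where
        nad≤same : pair nad i j ≤ ∑ (allFin r) (λ s → population b i s * population b j s)
        nad≤same = *-cancelˡ-≤ r (≤-trans (pair-density i≢j)
          (≤-trans (≤-reflexive (sym (cong₂ _*_ (∑-population b i) (∑-population b j))))
                   (chebyshev (population b i) (population b j) (same-order ji jj))))
        ring : ∀ x m z s → x + (s + (z + m)) + 0 ≡ m + (z + (x + s))
        ring = solve-∀

      private
        pair-missᵖ≤mono : ∀ i j → J i ≡ true → J j ≡ true → pair missᵖ i j ≤ pair (mono b) i j
        pair-missᵖ≤mono i j ji jj = from (i ≟ j)
          where
          from : Dec (i ≡ j) → pair missᵖ i j ≤ pair (mono b) i j
          from (no i≢j) = ≤-trans (pair-mono i j {missᵖ} {miss b} (λ u v →
            ≤-trans (*-monoʳ-≤ (miss b u v) (⟦⟧≤1 (not (does (proj₁ u ≟ proj₁ v))))) (≤-reflexive (*-identityʳ (miss b u v)))))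
            (pair-miss≤mono i≢j ji jj)
          from (yes refl) = ≤-trans (≤-reflexive (trans
            (mass-cong (allFin (size G i)) (λ _ → ω i) (λ a → trans
              (mass-cong (allFin (size G i)) (λ _ → ω i) (λ a′ → own (miss b (i , a) (i , a′))))
              (part-const i 0))) (part-const i 0))) z≤n
            where
            own : ∀ x → x * δ̅ i i ≡ 0
            own x = trans (cong (x *_) (δ̅-refl i)) (*-zeroʳ x)

        miss≤mono : missᴶ ≤ monoᴶ
        miss≤mono = subst₂ _≤_ (sym (bimass-parts J missᵖ)) (sym (bimass-parts J (mono b)))
          (selected-mono (λ i ji → selected-mono (λ j jj → pair-missᵖ≤mono i j ji jj)))
          where
          selected-mono : ∀ {φ ψ : Fin ℓ → ℕ} → (∀ i → J i ≡ true → φ i ≤ ψ i) →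
                          mass parts (⟦_⟧ ∘ J) φ ≤ mass parts (⟦_⟧ ∘ J) ψ
          selected-mono {φ} {ψ} h = ∑-mono parts pointwise
            where
            pointwise : ∀ i → ⟦ J i ⟧ * φ i ≤ ⟦ J i ⟧ * ψ i
            pointwise i with J i in ji
            ... | true  = *-monoʳ-≤ 1 (h i ji)
            ... | false = z≤n

      -- The inequalities 2 mono ≤ miss and miss ≤ mono are compatible only at zero.
      monoᴶ≡0 : bimass vertices (weight J) (weight J) (mono b) ≡ 0
      monoᴶ≡0 = n≤0⇒n≡0 (linear 0 (≤-trans 2mono≤miss miss≤mono) (ring monoᴶ))
        where
        ring : ∀ m → m + m + 0 ≡ 0 + 2 * m
        ring = solve-∀

      private
        missᴶ≡0 : missᴶ ≡ 0
        missᴶ≡0 = n≤0⇒n≡0 (≤-trans miss≤mono (≤-reflexive monoᴶ≡0))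

        vanishing : ∀ K → bimass vertices (weight J) (weight J) K ≡ 0 →
                    ∀ u v → J (proj₁ u) ≡ true → J (proj₁ v) ≡ true → K u v ≡ 0
        vanishing K e u v ju jv = mass-vanishing J (K u)
          (mass-vanishing J (λ u → mass vertices (weight J) (K u)) e u ju) v jv

      different-colour : ∀ u v → J (proj₁ u) ≡ true → J (proj₁ v) ≡ true → proj₁ u ≢ proj₁ v → b u ≢ b v → adj G u v ≡ true
      different-colour u v ju jv i≢j ne = from (adj G u v) (trans (trans (sym (*-identityʳ (nad u v))) (sym (*-identityʳ _)))
        (trans (cong₂ (λ x y → nad u v * x * y) (sym (δ̅-≢ ne)) (sym (δ̅-≢ i≢j))) (vanishing missᵖ missᴶ≡0 u v ju jv)))
        where
        from : ∀ x → ⟦ not x ⟧ ≡ 0 → x ≡ true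
        from true _ = refl

      private
        another : ∀ i → ∃[ j ] i ≢ j × J j ≡ true
        another i = from (∑-< parts (subst (_< M) (sym (∑-δ ℓ (λ _ → 1) i)) (≤-trans (m≤m*n 2 256) (≤-trans 512≤ 512r²≤M))))
          where
          512≤ : 2 * 256 ≤ 512 * (r * r)
          512≤ = m≤m*n 512 (r * r)
          from : (∃[ j ] δ i j * 1 < ⟦ J j ⟧) → ∃[ j ] i ≢ j × J j ≡ true
          from (j , lt) = j , (λ { refl → <-irrefl refl (<-≤-trans (subst (λ x → x * 1 < ⟦ J j ⟧) (δ-refl j) lt) (⟦⟧≤1 (J j))) }) , ⟦⟧-true (≤-<-trans z≤n lt)

      -- Without monochromatic edges the density condition reverses Chebyshev's inequality for part
      -- i and a second part j of J. A strict inequality between two classes of i holds in j too, as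
      -- both are ordered alike, and would make one rearrangement strict.
      population-≤ : ∀ i → J i ≡ true → ∀ s t → population b i s ≤ population b i t
      population-≤ i ji s t = ≮⇒≥ λ lt → <-irrefl refl (<-≤-trans
        (strict-rearrangement {p t} {p s} {q t} {q s} lt (≰⇒> (λ le → <⇒≱ lt (≤-transfer jj ji le))))
        (subst₂ _≤_ (+-comm (p s * q s) (p t * q t)) (+-comm (p s * q t) (p t * q s)) tight))
        where
        j = proj₁ (another i)
        i≢j = proj₁ (proj₂ (another i))
        jj = proj₂ (proj₂ (another i))
        p = population b i
        q = population b j
        S = ∑ (allFin r) (λ s → p s * q s)
        mono≡0 : pair (mono b) i j ≡ 0
        mono≡0 = trans (mass-cong (allFin (size G i)) (λ _ → ω i) (λ a → trans
          (mass-cong (allFin (size G j)) (λ _ → ω j) (λ a′ → vanishing (mono b) monoᴶ≡0 (i , a) (j , a′) ji jj))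
          (part-const j 0))) (part-const i 0)
        S≤nad : S ≤ pair nad i j
        S≤nad = ≤-trans (m≤n+m S (pair (miss b) i j)) (≤-reflexive (trans (sym (pair-balance b i j))
          (trans (cong (pair nad i j +_) mono≡0) (+-identityʳ _))))
        tight : p s * q s + p t * q t ≤ p s * q t + p t * q s
        tight = chebyshev-tight p q (same-order ji jj)
          (≤-trans (*-monoʳ-≤ r S≤nad) (≤-trans (pair-density i≢j)
            (≤-reflexive (sym (cong₂ _*_ (∑-population b i) (∑-population b j))))))
          (∈-allFin s) (∈-allFin t)

      population-equal : ∀ i → J i ≡ true → ∀ s → r * population b i s ≡ N
      population-equal i ji s = trans (sym (∑-const r (population b i s))) (trans
        (∑-cong (allFin r) (λ t → ≤-antisym (population-≤ i ji s t) (population-≤ i ji t s))) (∑-population b i))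

-- From J to a proper colouring of all vertices

two-thin-classes : ∀ r N M M′ z h h′ → 0 < N → 1 ≤ r → 512 * (r * r) ≤ M → M ≤ M′ + 1 →
  4 * (r * h) ≤ M * N + 4 * r * N → 4 * (r * h′) ≤ M * N + 4 * r * N →
  2 * (M′ * N) ≤ r * z + r * h + r * h′ → ¬ r * z ≤ M′ * N
two-thin-classes r N M M′ z h h′ 0<N 1≤r H₁ H₂ H₃ H₄ H₅ H₆ = <-irrefl refl (begin-strict
  4 * (r * z) + (4 * (r * h) + 4 * (r * h′)) + 2 * (M * N)
    ≤⟨ +-mono-≤ (+-mono-≤ (*-monoʳ-≤ 4 H₆) (+-mono-≤ H₃ H₄)) (*-monoʳ-≤ 2 (*-monoˡ-≤ N H₂)) ⟩
  4 * (M′ * N) + (M * N + 4 * r * N + (M * N + 4 * r * N)) + 2 * ((M′ + 1) * N) ≡⟨ ring₁ r N M M′ ⟩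
  2 * (M * N) + 6 * (M′ * N) + (8 * r + 2) * N <⟨ +-monoʳ-< (2 * (M * N) + 6 * (M′ * N)) (*-monoˡ-< N {{>-nonZero 0<N}} small) ⟩
  2 * (M * N) + 6 * (M′ * N) + 2 * M′ * N ≡⟨ ring₂ N M M′ ⟩
  2 * (M * N) + 4 * (2 * (M′ * N)) ≤⟨ +-monoʳ-≤ (2 * (M * N)) (*-monoʳ-≤ 4 H₅) ⟩
  2 * (M * N) + 4 * (r * z + r * h + r * h′) ≡⟨ ring₃ (M * N) (r * z) (r * h) (r * h′) ⟩
  4 * (r * z) + (4 * (r * h) + 4 * (r * h′)) + 2 * (M * N) ∎)
  where
  open ≤-Reasoning
  ring₁ : ∀ r N M M′ → 4 * (M′ * N) + (M * N + 4 * r * N + (M * N + 4 * r * N)) + 2 * ((M′ + 1) * N) ≡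
                      2 * (M * N) + 6 * (M′ * N) + (8 * r + 2) * N
  ring₁ = solve-∀
  ring₂ : ∀ N M M′ → 2 * (M * N) + 6 * (M′ * N) + 2 * M′ * N ≡ 2 * (M * N) + 4 * (2 * (M′ * N))
  ring₂ = solve-∀
  ring₃ : ∀ m z h h′ → 2 * m + 4 * (z + h + h′) ≡ 4 * z + (4 * h + 4 * h′) + 2 * m
  ring₃ = solve-∀
  small : 8 * r + 2 < 2 * M′
  small = linear (1011 * (r * r)) (+-mono-≤ (+-mono-≤ (*-monoʳ-≤ 2 H₁) (*-monoʳ-≤ 2 H₂))
    (+-mono-≤ (*-monoʳ-≤ (8 * r) 1≤r) (+-mono-≤ (*-monoʳ-≤ 5 1≤r) (*-monoʳ-≤ (5 * r) 1≤r)))) (ring r M M′)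
    where
    ring : ∀ r M M′ → suc (8 * r + 2) + (2 * M + 2 * (M′ + 1) + (8 * r * r + (5 * r + 5 * r * r))) + 1011 * (r * r) ≡
                      2 * M′ + (2 * (512 * (r * r)) + 2 * M + (8 * r * 1 + (5 * 1 + 5 * r * 1)))
    ring = solve-∀

no-thin-class : ∀ r N M n h → 0 < N → 1 ≤ r → 512 * (r * r) ≤ M →
  4 * r * h ≤ M * N → r * n ≡ M * N → ¬ n ≤ h + N + N
no-thin-class r N M n h 0<N 1≤r H₁ H₂ H₃ H₄ = <-irrefl refl (begin-strict
  4 * (M * N)                      ≡⟨ cong (4 *_) (sym H₃) ⟩
  4 * (r * n)                      ≤⟨ *-monoʳ-≤ 4 (*-monoʳ-≤ r H₄) ⟩
  4 * (r * (h + N + N))            ≡⟨ ring₁ r h N ⟩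
  4 * r * h + 8 * r * N            ≤⟨ +-monoˡ-≤ (8 * r * N) H₂ ⟩
  M * N + 8 * r * N                <⟨ +-monoʳ-< (M * N) (*-monoˡ-< N {{>-nonZero 0<N}} small) ⟩
  M * N + 3 * M * N                ≡⟨ ring₂ M N ⟩
  4 * (M * N)                      ∎)
  where
  open ≤-Reasoning
  ring₁ : ∀ r h N → 4 * (r * (h + N + N)) ≡ 4 * r * h + 8 * r * N
  ring₁ = solve-∀
  ring₂ : ∀ M N → M * N + 3 * M * N ≡ 4 * (M * N)
  ring₂ = solve-∀
  small : 8 * r < 3 * M
  small = linear (1527 * (r * r)) (+-mono-≤ (*-monoʳ-≤ 3 H₁)
    (+-mono-≤ (*-monoʳ-≤ (8 * r) 1≤r) (+-mono-≤ 1≤r (*-monoʳ-≤ r 1≤r)))) (ring r M)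
    where
    ring : ∀ r M → suc (8 * r) + (3 * M + (8 * r * r + (r + r * r))) + 1527 * (r * r) ≡
                   3 * M + (3 * (512 * (r * r)) + (8 * r * 1 + (1 + r * 1)))
    ring = solve-∀

δ-pos : ∀ {n} {i j : Fin n} → 0 < δ i j → i ≡ j
δ-pos {i = i} {j} lt with i ≟ j
... | yes p = p

module _ {ℓ} r₀ (G : PartiteGraph ℓ) (density : DensityCondition (suc (suc r₀)) G)
  (noClique : ¬ Cliques.Clique (adj G) (λ _ → ⊤) (suc (suc r₀))) where

  open Core r₀ G density noClique

  module Endgame
    (J : Fin ℓ → Bool) (b : Vertex G → Fin (suc r₀))
    (M-large : 512 * (r * r) ≤ ∥ J ∥) (M-large′ : 16 * (r * r * (r * r)) * 1 ≤ ∥ J ∥)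
    (few : bimass vertices (weight J) (weight J) (miss b) ≤ 1 * (∥ J ∥ * (N * N)))
    (different-colour : ∀ u v → J (proj₁ u) ≡ true → J (proj₁ v) ≡ true →
      proj₁ u ≢ proj₁ v → b u ≢ b v → adj G u v ≡ true)
    (population-equal : ∀ i → J i ≡ true → ∀ s → r * part i (λ v → δ (b v) s) ≡ N)
    where

    private
      M = ∥ J ∥
      Y = weight J

      -- The part of v itself may or may not belong to J.
      M′ : Fin ℓ → ℕ
      M′ i = mass parts (⟦_⟧ ∘ J) (δ̅ i)

      M≤M′+1 : ∀ i → M ≤ M′ i + 1
      M≤M′+1 i = begin
        M                                                ≡⟨ ∑-mass parts (⟦_⟧ ∘ J) ⟩
        mass parts (⟦_⟧ ∘ J) (λ _ → 1)                   ≤⟨ mass-≤+ parts (⟦_⟧ ∘ J) (δ̅ i) (δ i) (λ j → ≤-reflexive (trans (sym (δ+δ̅ i j)) (+-comm (δ i j) _))) ⟩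
        M′ i + mass parts (⟦_⟧ ∘ J) (δ i)                ≤⟨ +-monoʳ-≤ (M′ i) (∑-mono parts (λ j → ≤-trans (*-monoˡ-≤ (δ i j) (⟦⟧≤1 (J j))) (≤-reflexive (*-comm 1 (δ i j))))) ⟩
        M′ i + ∑ parts (λ j → δ i j * 1)                 ≡⟨ cong (M′ i +_) (∑-δ ℓ (λ _ → 1) i) ⟩
        M′ i + 1                                         ∎
        where open ≤-Reasoning

      gap-kernel : V → V → ℕ
      gap-kernel v x = nad v x * δ̅ (proj₁ v) (proj₁ x)

      hit gap rest : V → Fin r → ℕ
      hit v s = mass vertices Y (λ x → δ (b x) s * ad v x)
      gap v s = mass vertices Y (λ x → δ (b x) s * gap-kernel v x)
      rest v s = mass vertices Y (λ x → δ̅ (b x) s * gap-kernel v x)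

      z : V → ℕ
      z v = mass vertices Y (gap-kernel v)

      ad-own : ∀ v x → ad v x + gap-kernel v x ≡ δ̅ (proj₁ v) (proj₁ x)
      ad-own v x = from (proj₁ v ≟ proj₁ x)
        where
        from : Dec (proj₁ v ≡ proj₁ x) → ad v x + nad v x * δ̅ (proj₁ v) (proj₁ x) ≡ δ̅ (proj₁ v) (proj₁ x)
        from (yes p) = trans (cong (λ e → ⟦ e ⟧ + nad v x * δ̅ (proj₁ v) (proj₁ x)) (partite G v x p))
          (trans (cong (nad v x *_) δ̅≡0) (trans (*-zeroʳ (nad v x)) (sym δ̅≡0)))
          where
          δ̅≡0 : δ̅ (proj₁ v) (proj₁ x) ≡ 0
          δ̅≡0 = +-cancelˡ-≡ 1 _ 0 (trans (cong (_+ δ̅ (proj₁ v) (proj₁ x)) (sym (trans (cong (δ (proj₁ v)) (sym p)) (δ-refl (proj₁ v))))) (δ+δ̅ (proj₁ v) (proj₁ x)))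
        from (no ¬p) = trans (cong (λ e → ad v x + nad v x * e) (δ̅-≢ ¬p))
          (trans (cong (ad v x +_) (*-identityʳ (nad v x))) (trans (ad+nad v x) (sym (δ̅-≢ ¬p))))

      selected-cong : ∀ {φ ψ : Fin ℓ → ℕ} → (∀ i → J i ≡ true → φ i ≡ ψ i) →
                      mass parts (⟦_⟧ ∘ J) φ ≡ mass parts (⟦_⟧ ∘ J) ψ
      selected-cong {φ} {ψ} h = ∑-cong parts pointwise
        where
        pointwise : ∀ i → ⟦ J i ⟧ * φ i ≡ ⟦ J i ⟧ * ψ i
        pointwise i with J i in ji
        ... | true  = cong (1 *_) (h i ji)
        ... | false = refl

      class-size : ∀ (χ : Fin ℓ → ℕ) s →
        r * mass vertices Y (λ x → δ (b x) s * χ (proj₁ x)) ≡ mass parts (⟦_⟧ ∘ J) χ * N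
      class-size χ s = begin
        r * mass vertices Y (λ x → δ (b x) s * χ (proj₁ x))
          ≡⟨ cong (r *_) (mass-parts J (λ x → δ (b x) s * χ (proj₁ x))) ⟩
        r * mass parts (⟦_⟧ ∘ J) (λ j → part j (λ x → δ (b x) s * χ (proj₁ x)))
          ≡⟨ sym (mass-*ˡ parts (⟦_⟧ ∘ J) r (λ j → part j (λ x → δ (b x) s * χ (proj₁ x)))) ⟩
        mass parts (⟦_⟧ ∘ J) (λ j → r * part j (λ x → δ (b x) s * χ (proj₁ x)))
          ≡⟨ selected-cong (λ j jj → trans
               (cong (r *_) (mass-*ʳ (allFin (size G j)) (λ _ → ω j) (χ j) (λ a → δ (b (j , a)) s)))
               (trans (sym (*-assoc r (part j (λ x → δ (b x) s)) (χ j))) (trans (cong (_* χ j) (population-equal j jj s)) (*-comm N (χ j))))) ⟩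
        mass parts (⟦_⟧ ∘ J) (λ j → χ j * N)
          ≡⟨ mass-*ʳ parts (⟦_⟧ ∘ J) N χ ⟩
        mass parts (⟦_⟧ ∘ J) χ * N ∎
        where open ≡-Reasoning

      hit+gap : ∀ v s → r * (hit v s + gap v s) ≡ M′ (proj₁ v) * N
      hit+gap v s = trans (cong (r *_) (trans
        (sym (mass-+ vertices Y (λ x → δ (b x) s * ad v x) (λ x → δ (b x) s * gap-kernel v x)))
        (mass-cong vertices Y (λ x → trans (sym (*-distribˡ-+ (δ (b x) s) (ad v x) (gap-kernel v x)))
                                            (cong (δ (b x) s *_) (ad-own v x))))))
        (class-size (δ̅ (proj₁ v)) s)

      z-split : ∀ v s → z v ≡ gap v s + rest v s
      z-split v s = trans (mass-cong vertices Y (λ x → trans (sym (*-identityˡ (gap-kernel v x)))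
          (trans (cong (_* gap-kernel v x) (sym (δ+δ̅ (b x) s))) (*-distribʳ-+ (gap-kernel v x) (δ (b x) s) (δ̅ (b x) s)))))
        (mass-+ vertices Y (λ x → δ (b x) s * gap-kernel v x) (λ x → δ̅ (b x) s * gap-kernel v x))

      two-gaps : ∀ v {s t} → s ≢ t → gap v s + gap v t ≤ z v
      two-gaps v {s} {t} s≢t = ≤-trans
        (≤-reflexive (sym (mass-+ vertices Y (λ x → δ (b x) s * gap-kernel v x) (λ x → δ (b x) t * gap-kernel v x))))
        (mass-mono vertices Y (λ x → ≤-trans (≤-reflexive (sym (*-distribʳ-+ (gap-kernel v x) (δ (b x) s) (δ (b x) t))))
          (≤-trans (*-monoˡ-≤ (gap-kernel v x) (disjoint (b x))) (≤-reflexive (*-identityˡ (gap-kernel v x))))))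
        where
        disjoint : ∀ c → δ c s + δ c t ≤ 1
        disjoint c with c ≟ s | c ≟ t
        ... | yes p | yes q = contradiction (trans (sym p) q) s≢t
        ... | yes _ | no _  = ≤-refl
        ... | no _  | yes _ = ≤-refl
        ... | no _  | no _  = z≤n

      -- Take a neighbour u of v in class s of J. Their common neighbourhood is thin in some class
      -- t, but u is joined to all of class t in J outside its own part; so the neighbourhood of v
      -- alone is thin there, up to N.
      another-thin-class : ∀ v s → 0 < hit v s → ∃[ t ] t ≢ s × 4 * (r * hit v t) ≤ M * N + 4 * r * N
      another-thin-class v s pos = found (∑-pos vertices pos)
        where
        found : (∃[ u ] 0 < weight J u * (δ (b u) s * ad v u)) → ∃[ t ] t ≢ s × 4 * (r * hit v t) ≤ M * N + 4 * r * N
        found (u , lt) = from (some-class-thin J b 1 few M-large′ v u vu s)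
          where
          ju : J (proj₁ u) ≡ true
          ju = ⟦⟧-true (0<*ˡ {⟦ J (proj₁ u) ⟧} {ω (proj₁ u)} (0<*ˡ {weight J u} lt))
          bu : b u ≡ s
          bu = δ-pos (0<*ˡ {δ (b u) s} (0<*ʳ {weight J u} lt))
          vu : adj G v u ≡ true
          vu = ⟦⟧-true (0<*ʳ {δ (b u) s} (0<*ʳ {weight J u} lt))
          from : (∃[ t ] t ≢ s × 4 * r * mass vertices Y (λ x → δ (b x) t * ad² v u x) ≤ M * N) → _
          from (t , t≢s , thin) = t , t≢s , (begin
            4 * (r * hit v t)                       ≤⟨ *-monoʳ-≤ 4 (*-monoʳ-≤ r cover) ⟩
            4 * (r * (common + N))                  ≡⟨ ring r common N ⟩
            4 * r * common + 4 * r * N              ≤⟨ +-monoˡ-≤ (4 * r * N) thin ⟩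
            M * N + 4 * r * N                       ∎)
            where
            open ≤-Reasoning
            common = mass vertices Y (λ x → δ (b x) t * ad² v u x)
            ring : ∀ r c N → 4 * (r * (c + N)) ≡ 4 * r * c + 4 * r * N
            ring = solve-∀
            pointwise : ∀ x → J (proj₁ x) ≡ true →
              δ (b x) t * ad v x ≤ δ (b x) t * ad² v u x + δ (proj₁ u) (proj₁ x)
            pointwise x jx with b x ≟ t | proj₁ u ≟ proj₁ x
            ... | no _  | _     = z≤n
            ... | yes _ | yes _ = ≤-trans (*-monoʳ-≤ 1 (ad≤1 v x)) (m≤n+m 1 _)
            ... | yes p | no i≢ = ≤-reflexive (trans (cong (1 *_) (sym both)) (sym (+-identityʳ _)))
              where
              both : ad² v u x ≡ ad v x
              both = trans (cong (λ e → ⟦ adj G v x ∧ e ⟧) (different-colour u x ju jx i≢ (λ q → t≢s (trans (sym p) (trans (sym q) bu)))))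
                           (cong ⟦_⟧ (Bool.∧-identityʳ (adj G v x)))
            cover : hit v t ≤ common + N
            cover = ≤-trans (mass-monoᴶ J pointwise) (≤-trans
              (≤-reflexive (mass-+ vertices Y (λ x → δ (b x) t * ad² v u x) (λ x → δ (proj₁ u) (proj₁ x))))
              (+-monoʳ-≤ common (own-part J (proj₁ u))))

      T : V → ℕ
      T v = M′ (proj₁ v) * N

      -- The previous lemma, applied to class zero and then to the class t it returns, yields two
      -- different thin classes. The vertex v misses about three quarters of each, which is more
      -- than one whole class.
      all-hit : ∀ v → (∀ s → 0 < hit v s) → ¬ r * z v ≤ T v
      all-hit v pos = from (another-thin-class v zero (pos zero))
        where
        from : (∃[ t ] t ≢ zero × 4 * (r * hit v t) ≤ M * N + 4 * r * N) → ¬ r * z v ≤ T v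
        from (t , _ , thin) = from′ (another-thin-class v t (pos t))
          where
          from′ : (∃[ t′ ] t′ ≢ t × 4 * (r * hit v t′) ≤ M * N + 4 * r * N) → ¬ r * z v ≤ T v
          from′ (t′ , t′≢t , thin′) = two-thin-classes r N M (M′ (proj₁ v)) (z v) (hit v t) (hit v t′)
            0<N (s≤s z≤n) M-large (M≤M′+1 (proj₁ v)) thin thin′
            (linear 0 (+-mono-≤ (*-monoʳ-≤ r (two-gaps v (t′≢t ∘ sym)))
                                (≤-reflexive (sym (cong₂ _+_ (hit+gap v t) (hit+gap v t′)))))
              (ring r (T v) (hit v t) (hit v t′) (gap v t) (gap v t′) (z v)))
            where
            ring : ∀ r T h h′ g g′ z → 2 * T + (r * z + (r * (h + g) + r * (h′ + g′))) + 0 ≡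
                   r * z + r * h + r * h′ + (r * (g + g′) + (T + T))
            ring = solve-∀

      no-hit : ∀ v s → hit v s ≡ 0 → r * gap v s ≡ T v
      no-hit v s e = trans (cong (λ h → r * (h + gap v s)) (sym e)) (hit+gap v s)

      some-hit? : ∀ v → (∃[ s ] hit v s ≡ 0) ⊎ (∀ s → 0 < hit v s)
      some-hit? v with any? (λ s → hit v s ≟ℕ 0)
      ... | yes p = inj₁ p
      ... | no ¬p = inj₂ (λ s → n≢0⇒n>0 (λ e → ¬p (s , e)))

      -- A vertex misses either one class entirely or, by `all-hit`, more than the weight of a class
      -- in total.
      T≤rz : ∀ v → T v ≤ r * z v
      T≤rz v = from (some-hit? v)
        where
        from : (∃[ s ] hit v s ≡ 0) ⊎ (∀ s → 0 < hit v s) → T v ≤ r * z v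
        from (inj₁ (s , e)) = ≤-trans (≤-reflexive (sym (no-hit v s e)))
          (*-monoʳ-≤ r (≤-trans (m≤m+n (gap v s) (rest v s)) (≤-reflexive (sym (z-split v s)))))
        from (inj₂ pos) = <⇒≤ (≰⇒> (all-hit v pos))

      average : ∀ i → part i (λ v → r * z v) ≤ part i T
      average i = begin
        part i (λ v → r * z v) ≡⟨ mass-*ˡ (allFin (size G i)) (λ _ → ω i) r (λ a → z (i , a)) ⟩
        r * part i z ≡⟨ cong (r *_) (mass-cong (allFin (size G i)) (λ _ → ω i) (λ a → mass-parts J (gap-kernel (i , a)))) ⟩
        r * part i (λ v → mass parts (⟦_⟧ ∘ J) (λ j → part j (gap-kernel v)))
          ≡⟨ cong (r *_) (mass-swap (allFin (size G i)) parts (λ _ → ω i) (⟦_⟧ ∘ J) (λ a j → part j (gap-kernel (i , a)))) ⟩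
        r * mass parts (⟦_⟧ ∘ J) (pair gap-kernel i)
          ≡⟨ sym (mass-*ˡ parts (⟦_⟧ ∘ J) r (pair gap-kernel i)) ⟩
        mass parts (⟦_⟧ ∘ J) (λ j → r * pair gap-kernel i j) ≤⟨ mass-mono parts (⟦_⟧ ∘ J) bound ⟩
        mass parts (⟦_⟧ ∘ J) (λ j → δ̅ i j * (N * N)) ≡⟨ mass-*ʳ parts (⟦_⟧ ∘ J) (N * N) (δ̅ i) ⟩
        M′ i * (N * N)     ≡⟨ sym (*-assoc (M′ i) N N) ⟩
        M′ i * N * N       ≡⟨ sym (part-const i (M′ i * N)) ⟩
        part i T           ∎
        where
        open ≤-Reasoning
        bound : ∀ j → r * pair gap-kernel i j ≤ δ̅ i j * (N * N)
        bound j = ≤-trans (≤-reflexive (cong (r *_) factor)) (from (i ≟ j))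
          where
          factor : pair gap-kernel i j ≡ pair nad i j * δ̅ i j
          factor = trans (mass-cong (allFin (size G i)) (λ _ → ω i) (λ a →
              mass-*ʳ (allFin (size G j)) (λ _ → ω j) (δ̅ i j) (λ a′ → nad (i , a) (j , a′))))
            (mass-*ʳ (allFin (size G i)) (λ _ → ω i) (δ̅ i j) (λ a → part j (nad (i , a))))
          from : Dec (i ≡ j) → r * (pair nad i j * δ̅ i j) ≤ δ̅ i j * (N * N)
          from (yes refl) = ≤-trans (≤-reflexive (trans (cong (λ e → r * (pair nad i i * e)) (δ̅-refl i))
            (trans (cong (r *_) (*-zeroʳ (pair nad i i))) (*-zeroʳ r)))) z≤n
          from (no i≢j) = subst (λ e → r * (pair nad i j * e) ≤ e * (N * N)) (sym (δ̅-≢ i≢j))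
            (≤-trans (≤-reflexive (cong (r *_) (*-identityʳ (pair nad i j)))) (≤-trans (pair-density i≢j) (≤-reflexive (sym (*-identityˡ (N * N))))))

      -- `T≤rz` bounds every vertex of the part from below and density bounds their average by the
      -- same value, so equality holds at each vertex.
      rz≤T : ∀ v → r * z v ≤ T v
      rz≤T (i , a) = *-cancelˡ-≤ (ω i) {{>-nonZero (0<ω i)}}
        (∑-tight {f = λ a → ω i * (r * z (i , a))} {g = λ a → ω i * T (i , a)}
          (λ a → *-monoʳ-≤ (ω i) (T≤rz (i , a))) (average i) (∈-allFin a))

      uncoloured : ∀ v → ∃[ s ] hit v s ≡ 0
      uncoloured v = from (some-hit? v)
        where
        from : (∃[ s ] hit v s ≡ 0) ⊎ (∀ s → 0 < hit v s) → ∃[ s ] hit v s ≡ 0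
        from (inj₁ p)   = p
        from (inj₂ pos) = contradiction (rz≤T v) (all-hit v pos)

    -- Read off from adjacency to J for every vertex, those of J included, instead of being copied
    -- from `b` there; properness then needs no distinction of cases.
    colour : V → Fin r
    colour v = proj₁ (uncoloured v)

    private
      -- The class `colour v`, missed entirely, already uses up all the missing weight that `rz≤T`
      -- grants to v.
      rest≡0 : ∀ v → rest v (colour v) ≡ 0
      rest≡0 v = n≤0⇒n≡0 (*-cancelˡ-≤ r (+-cancelˡ-≤ (r * gap v s) _ _ (begin
        r * gap v s + r * rest v s ≡⟨ sym (*-distribˡ-+ r (gap v s) (rest v s)) ⟩
        r * (gap v s + rest v s)   ≡⟨ cong (r *_) (sym (z-split v s)) ⟩
        r * z v                    ≤⟨ rz≤T v ⟩
        T v                        ≡⟨ sym (no-hit v s (proj₂ (uncoloured v))) ⟩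
        r * gap v s                ≡⟨ sym (+-identityʳ (r * gap v s)) ⟩
        r * gap v s + 0            ≡⟨ cong (r * gap v s +_) (sym (*-zeroʳ r)) ⟩
        r * gap v s + r * 0        ∎)))
        where
        open ≤-Reasoning
        s = colour v

    joined : ∀ v x → J (proj₁ x) ≡ true → proj₁ v ≢ proj₁ x → b x ≢ colour v → adj G v x ≡ true
    joined v x jx i≢ ne = from (adj G v x) (trans
      (trans (ring (nad v x)) (cong₂ (λ p q → p * (nad v x * q)) (sym (δ̅-≢ ne)) (sym (δ̅-≢ i≢))))
      (mass-vanishing J (λ x → δ̅ (b x) (colour v) * gap-kernel v x) (rest≡0 v) x jx))
      where
      ring : ∀ n → n ≡ 1 * (n * 1)
      ring = solve-∀
      from : ∀ p → ⟦ not p ⟧ ≡ 0 → p ≡ true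
      from true _ = refl

    -- Adjacent vertices of equal colour are both joined to every other class of J, apart from their
    -- own parts. Hence no such class is thin in their common neighbourhood, contrary to
    -- `some-class-thin`.
    colour-proper : ∀ u v → adj G u v ≡ true → colour u ≢ colour v
    colour-proper u v uv same = from (some-class-thin J b 1 few M-large′ u v uv (colour u))
      where
      from : ¬ (∃[ t ] t ≢ colour u × 4 * r * mass vertices Y (λ x → δ (b x) t * ad² u v x) ≤ M * N)
      from (t , t≢s , thin) = no-thin-class r N M (mass vertices Y (λ x → δ (b x) t * 1)) common 0<N (s≤s z≤n) M-large thin
        (trans (class-size (λ _ → 1) t) (cong (_* N) (sym (∑-mass parts (⟦_⟧ ∘ J)))))
        (≤-trans (mass-monoᴶ J pointwise) (≤-trans
          (≤-reflexive (trans (mass-+ vertices Y (λ x → δ (b x) t * ad² u v x + δ (proj₁ u) (proj₁ x)) (λ x → δ (proj₁ v) (proj₁ x)))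
            (cong (_+ mass vertices Y (λ x → δ (proj₁ v) (proj₁ x)))
                  (mass-+ vertices Y (λ x → δ (b x) t * ad² u v x) (λ x → δ (proj₁ u) (proj₁ x))))))
          (+-mono-≤ (+-monoʳ-≤ common (own-part J (proj₁ u))) (own-part J (proj₁ v)))))
        where
        common = mass vertices Y (λ x → δ (b x) t * ad² u v x)
        pointwise : ∀ x → J (proj₁ x) ≡ true →
          δ (b x) t * 1 ≤ δ (b x) t * ad² u v x + δ (proj₁ u) (proj₁ x) + δ (proj₁ v) (proj₁ x)
        pointwise x jx with b x ≟ t | proj₁ u ≟ proj₁ x | proj₁ v ≟ proj₁ x
        ... | no _  | _     | _     = z≤n
        ... | yes _ | _     | yes _ = m≤n+m 1 _
        ... | yes _ | yes _ | no _  = ≤-trans (m≤n+m 1 (1 * ad² u v x)) (m≤m+n (1 * ad² u v x + 1) 0)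
        ... | yes p | no i≢ | no j≢ = ≤-trans (≤-reflexive (sym (cong (1 *_) both))) (≤-trans (m≤m+n _ 0) (m≤m+n _ 0))
          where
          both : ad² u v x ≡ 1
          both = cong₂ (λ p q → ⟦ p ∧ q ⟧)
            (joined u x jx i≢ (λ q → t≢s (trans (sym p) q)))
            (joined v x jx j≢ (λ q → t≢s (trans (sym p) (trans q (sym same)))))

-- The constants and the assembly of the colouring

summands-≤ : ∀ x y z {l} → x + y + z ≤ l → x ≤ l × y ≤ l × z ≤ l
summands-≤ x y z le = ≤-trans (m≤m+n x y) xy≤ , ≤-trans (m≤n+m y x) xy≤ , ≤-trans (m≤n+m z (x + y)) le
  where xy≤ = ≤-trans (m≤m+n (x + y) z) le
module _ (r₀ : ℕ) where

  private
    r = suc r₀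
    pairs : List (Fin r × Fin r)
    pairs = cartesianProduct (allFin r) (allFin r)

  -- patterns bounds the number of orderings of the class weights inside a part, and
  -- core-size the number of parts needed in J; the constants are not optimised.
  patterns core-size colouring-threshold : ℕ
  patterns = 2 ^ length pairs
  core-size = 512 * (r * r * (r * r)) * suc patterns
  colouring-threshold = patterns * core-size + 8 * (r * r) +
                        2 * (r * r) * (64 * r * patterns * (64 * r * patterns))

  module _ {ℓ} (large : colouring-threshold ≤ ℓ) (G : PartiteGraph ℓ) (density : DensityCondition (suc (suc r₀)) G)
    (noClique : ¬ Cliques.Clique (adj G) (λ _ → ⊤) (suc (suc r₀))) where

    private
      open Core r₀ G density noClique hiding (r)

      bounds = summands-≤ (patterns * core-size) (8 * (r * r))
        (2 * (r * r) * (64 * r * patterns * (64 * r * patterns))) large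

      0<patterns : 0 < patterns
      0<patterns = m^n>0 2 (length pairs)

      colouring-from : (c b : V → Fin r) →
        bimass vertices (weight everything) (weight everything) (mono c) ≤ 1 * (∥ everything ∥ * (N * N)) →
        (∀ v → 64 * r * patterns * mass vertices (weight everything) (λ x → δ (c x) (b v) * ad v x) ≤ ∥ everything ∥ * N) →
        mass vertices (weight everything) (λ u → δ̅ (b u) (c u)) ≤ 8 * r * N →
        ∥ everything ∥ ≡ ℓ →
        Σ (V → Fin r) λ f → ∀ u v → adj G u v ≡ true → f u ≢ f v
      colouring-from c b few toward-b disagreement L≡ℓ =
        from (pigeonhole parts everything (λ (s , t) i → population b i s ≤ᵇ population b i t) pairs)
        where
        from : (Σ (Fin ℓ → Bool) λ J →
                 (∀ p → p ∈ pairs → ∀ i j → J i ≡ true → J j ≡ true →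
                   (population b i (proj₁ p) ≤ᵇ population b i (proj₂ p)) ≡ (population b j (proj₁ p) ≤ᵇ population b j (proj₂ p))) ×
                 ∥ everything ∥ ≤ patterns * ∥ J ∥ × (∀ i → J i ≡ true → everything i ≡ true)) →
               Σ (V → Fin r) λ f → ∀ u v → adj G u v ≡ true → f u ≢ f v
        from (J , constant , L≤QM , _) = colour , colour-proper
          where
          M-large : core-size ≤ ∥ J ∥
          M-large = *-cancelˡ-≤ patterns {{>-nonZero 0<patterns}}
            (≤-trans (proj₁ bounds) (≤-trans (≤-reflexive (sym L≡ℓ)) L≤QM))
          open Exact r₀ G density noClique patterns 0<patterns c b few toward-b disagreement J L≤QM M-large
            using (512r²≤M; 16r⁴κ≤M; module Rigid)
          open Rigid (λ s t → constant (s , t) (∈-cartesianProduct⁺ (∈-allFin s) (∈-allFin t)))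
          -- `monoᴶ≡0` permits κ = 0, and so the factor 1 in the bound on `miss` that `Endgame`
          -- starts from.
          open Classes J b 0 (≤-reflexive monoᴶ≡0) using (miss-bound)
          open Endgame r₀ G density noClique J b 512r²≤M (16r⁴κ≤M (s≤s z≤n)) miss-bound different-colour population-equal

    proper-colouring : Σ (V → Fin r) λ f → ∀ u v → adj G u v ≡ true → f u ≢ f v
    proper-colouring = colouring-from R.c R.b R.few R.toward-b R.disagreement R.L≡ℓ
      where
      module R = Recolouring r₀ G density noClique patterns 0<patterns
        (proj₁ (proj₂ bounds)) (proj₂ (proj₂ bounds))

-- Construction of the class graph

transpose-matchˡ : ∀ {n} (i j : Fin n) → transpose i j ⟨$⟩ʳ i ≡ j
transpose-matchˡ i j with i ≟ i
... | yes _ = refl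
... | no ¬p = contradiction refl ¬p

transpose-mismatch : ∀ {n} {i j k : Fin n} → k ≢ i → k ≢ j → transpose i j ⟨$⟩ʳ k ≡ k
transpose-mismatch {i = i} {j} {k} k≢i k≢j with k ≟ i
... | yes p = contradiction p k≢i
... | no _ with k ≟ j
...   | yes q = contradiction q k≢j
...   | no _  = refl

-- Selection sort: a transposition brings a maximum to the front and `lift₀` sorts the remainder.
sorting : ∀ r (p : Fin r → ℕ) →
  Σ (Permutation′ r) λ σ → ∀ a b → toℕ a ≤ toℕ b → p (σ ⟨$⟩ʳ b) ≤ p (σ ⟨$⟩ʳ a)
sorting zero    p = Perm.id , λ ()
sorting (suc r) p with maximum r p
  where
  maximum : ∀ r (p : Fin (suc r) → ℕ) → ∃[ m ] (∀ i → p i ≤ p m)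
  maximum zero    p = zero , λ where zero → ≤-refl
  maximum (suc r) p with maximum r (p ∘ suc)
  ... | m , max with ≤-total (p zero) (p (suc m))
  ...   | inj₁ le = suc m , λ where
    zero    → le
    (suc i) → max i
  ...   | inj₂ ge = zero , λ where
    zero    → ≤-refl
    (suc i) → ≤-trans (max i) ge
... | m , max with sorting r (λ i → p (transpose zero m ⟨$⟩ʳ suc i))
...   | σ , sorted = lift₀ σ ∘ₚ transpose zero m , λ where
  zero    b       _        → subst (p (transpose zero m ⟨$⟩ʳ (lift₀ σ ⟨$⟩ʳ b)) ≤_) (cong p (sym (transpose-matchˡ zero m))) (max _)
  (suc a) (suc b) (s≤s le) → sorted a b le

-- One correcting transposition per element. It leaves the values already fixed alone, because both
-- τ and e are injective on the list.
extend-injection : ∀ {n} (xs : List (Fin n)) → Unique xs → (e : Fin n → Fin n) →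
  (∀ {x y} → x ∈ xs → y ∈ xs → e x ≡ e y → x ≡ y) →
  Σ (Permutation′ n) λ τ → ∀ {x} → x ∈ xs → τ ⟨$⟩ʳ x ≡ e x
extend-injection []       _          e inj = Perm.id , λ ()
extend-injection (x ∷ xs) (x∉ ∷ uxs) e inj with extend-injection xs uxs e (λ p q → inj (there p) (there q))
... | τ , agrees = τ ∘ₚ transpose (τ ⟨$⟩ʳ x) (e x) , λ where
  (here refl)     → transpose-matchˡ (τ ⟨$⟩ʳ x) (e x)
  (there {x = _} {xs = _} y∈) → let x≢y = All.lookup x∉ y∈ in
    trans (transpose-mismatch
      (λ eq → x≢y (trans (sym (inverseˡ τ)) (trans (cong (τ ⟨$⟩ˡ_) (sym eq)) (inverseˡ τ))))
      (λ eq → x≢y (inj (here refl) (there y∈) (trans (sym eq) (agrees y∈))))) (agrees y∈)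

unique-lookup : ∀ {xs : List A} → Unique xs → ∀ i j → lookup xs i ≡ lookup xs j → i ≡ j
unique-lookup (_  ∷ _)  zero    zero    e = refl
unique-lookup (x∉ ∷ _)  zero    (suc j) e = contradiction e (All.lookup x∉ (∈-lookup j))
unique-lookup (x∉ ∷ _)  (suc i) zero    e = contradiction (sym e) (All.lookup x∉ (∈-lookup i))
unique-lookup (_  ∷ us) (suc i) (suc j) e = cong suc (unique-lookup us i j e)

length-filter : ∀ {P : A → Set} (P? : Decidable P) xs → length (filter P? xs) ≡ ∑ xs (λ x → ⟦ does (P? x) ⟧)
length-filter P? []       = refl
length-filter P? (x ∷ xs) with does (P? x)
... | true  = cong suc (length-filter P? xs)
... | false = length-filter P? xs

module Fibres {m r} (f : Fin m → Fin r) where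

  fibre : Fin r → List (Fin m)
  fibre s = filter (λ a → f a ≟ s) (allFin m)

  element : ∀ s → Fin (length (fibre s)) → Fin m
  element s t = lookup (fibre s) t

  f-element : ∀ s t → f (element s t) ≡ s
  f-element s t = proj₂ (∈-filter⁻ (λ a → f a ≟ s) {xs = allFin m} (∈-lookup t))

  private
    position : ∀ a s → f a ≡ s → Fin (length (fibre s))
    position a s e = Any.index (∈-filter⁺ (λ a → f a ≟ s) (∈-allFin a) e)

    element-position : ∀ a s e → element s (position a s e) ≡ a
    element-position a s e = sym (lookup-index (∈-filter⁺ (λ a → f a ≟ s) (∈-allFin a) e))

    position-element : ∀ a s t (e : f a ≡ s) → element s t ≡ a →
      _≡_ {A = Σ (Fin r) (λ s → Fin (length (fibre s)))} (f a , position a (f a) refl) (s , t)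
    position-element a s t refl q = cong (s ,_) (unique-lookup (Unique.filter⁺ (λ a → f a ≟ s) (Unique.allFin⁺ m)) _ t
      (trans (element-position a s refl) (sym q)))

  -- Regroups a part by colours: (s , t) stands for the t-th vertex of colour s, the shape that
  -- `CVertex` demands.
  fibration : Σ (Fin r) (λ s → Fin (length (fibre s))) ↔ Fin m
  fibration = mk↔ₛ′ (λ (s , t) → element s t) (λ a → f a , position a (f a) refl)
    (λ a → element-position a (f a) refl)
    (λ (s , t) → position-element (element s t) s t (f-element s t) refl)

module ClassConstruction {ℓ} r₀ (G : PartiteGraph ℓ) (density : DensityCondition (suc (suc r₀)) G)
  (noClique : ¬ Cliques.Clique (adj G) (λ _ → ⊤) (suc (suc r₀)))
  (E : PermEnumeration (suc r₀)) (large : (suc r₀) ! ≤ ℓ)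
  (c : Vertex G → Fin (suc r₀)) (proper : ∀ u v → adj G u v ≡ true → c u ≢ c v) where

  open Core r₀ G density noClique

  private
    p : Fin ℓ → Fin r → ℕ
    p = population c

    module F (i : Fin ℓ) = Fibres (λ a → c (i , a))

    cnt : Fin ℓ → Fin r → ℕ
    cnt i s = length (F.fibre i s)

    p≡ω*cnt : ∀ i s → p i s ≡ ω i * cnt i s
    p≡ω*cnt i s = trans (∑-distrib-*ˡ (allFin (size G i)) (ω i) (λ a → δ (c (i , a)) s))
      (cong (ω i *_) (sym (length-filter (λ a → c (i , a) ≟ s) (allFin (size G i)))))

    cnt-≤ : ∀ i s t → p i s ≤ p i t → cnt i s ≤ cnt i t
    cnt-≤ i s t le = *-cancelˡ-≤ (ω i) {{>-nonZero (0<ω i)}} (subst₂ _≤_ (p≡ω*cnt i s) (p≡ω*cnt i t) le)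

    mono≡0 : ∀ i j → pair (mono c) i j ≡ 0
    mono≡0 i j = trans (pair-cong i j none) (trans (mass-cong (allFin (size G i)) (λ _ → ω i) (λ _ → part-const j 0)) (part-const i 0))
      where
      none : ∀ u v → mono c u v ≡ 0
      none u v with adj G u v in uv
      ... | false = refl
      ... | true  = trans (+-identityʳ _) (δ-≢ (proper u v uv))

    agreement : Fin ℓ → Fin ℓ → ℕ
    agreement i j = ∑ (allFin r) (λ s → p i s * p j s)

    nad≡ : ∀ i j → pair nad i j ≡ pair (miss c) i j + agreement i j
    nad≡ i j = trans (sym (+-identityʳ _)) (trans (cong (pair nad i j +_) (sym (mono≡0 i j))) (pair-balance c i j))

    -- Chebyshev's inequality reversed: a proper colouring has no monochromatic edges, so all pairs
    -- of equal colour are non-adjacent and density limits them.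
    r*agreement≤ : ∀ {i j} → i ≢ j → r * agreement i j ≤ ∑ (allFin r) (p i) * ∑ (allFin r) (p j)
    r*agreement≤ {i} {j} i≢j = ≤-trans (*-monoʳ-≤ r (≤-trans (m≤n+m (agreement i j) (pair (miss c) i j)) (≤-reflexive (sym (nad≡ i j)))))
      (≤-trans (pair-density i≢j) (≤-reflexive (sym (cong₂ _*_ (∑-population c i) (∑-population c j)))))

    Constant : Fin ℓ → Set
    Constant i = ∀ s t → p i s ≡ p i t

    constant? : Decidable Constant
    constant? i = all? (λ s → all? (λ t → p i s ≟ℕ p i t))

    constant-agreement : ∀ i j → Constant i → r * agreement i j ≡ N * N
    constant-agreement i j const = begin
      r * agreement i j                           ≡⟨ sym (∑-distrib-*ˡ (allFin r) r (λ s → p i s * p j s)) ⟩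
      ∑ (allFin r) (λ s → r * (p i s * p j s))  ≡⟨ ∑-cong (allFin r) (λ s → trans (sym (*-assoc r (p i s) (p j s))) (cong (_* p j s) (full s))) ⟩
      ∑ (allFin r) (λ s → N * p j s)            ≡⟨ ∑-distrib-*ˡ (allFin r) N (p j) ⟩
      N * ∑ (allFin r) (p j)                    ≡⟨ cong (N *_) (∑-population c j) ⟩
      N * N                                     ∎
      where
      open ≡-Reasoning
      full : ∀ s → r * p i s ≡ N
      full s = trans (sym (∑-const r (p i s))) (trans (∑-cong (allFin r) (λ t → const s t)) (∑-population c i))

    agreement-sym : ∀ i j → agreement i j ≡ agreement j i
    agreement-sym i j = ∑-cong (allFin r) (λ s → *-comm (p i s) (p j s))

    -- Density leaves no room for a missing edge next to a balanced part.
    complete : ∀ {i j} → i ≢ j → Constant i ⊎ Constant j → ∀ a b → c (i , a) ≢ c (j , b) → adj G (i , a) (j , b) ≡ true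
    complete {i} {j} i≢j const a b ne = from (adj G (i , a) (j , b)) (trans (sym (*-identityʳ _)) (trans (cong (nad (i , a) (j , b) *_) (sym (δ̅-≢ ne))) miss≡0))
      where
      from : ∀ x → ⟦ not x ⟧ ≡ 0 → x ≡ true
      from true _ = refl
      full : Constant i ⊎ Constant j → r * agreement i j ≡ N * N
      full (inj₁ q) = constant-agreement i j q
      full (inj₂ q) = trans (cong (r *_) (agreement-sym i j)) (constant-agreement j i q)
      pair-miss≡0 : pair (miss c) i j ≡ 0
      pair-miss≡0 = n≤0⇒n≡0 (+-cancelʳ-≤ (agreement i j) _ 0 (subst (_≤ agreement i j) (nad≡ i j)
        (*-cancelˡ-≤ r (≤-trans (pair-density i≢j) (≤-reflexive (sym (full const)))))))
      zero-at : ∀ k (φ : Fin (size G k) → ℕ) → mass (allFin (size G k)) (λ _ → ω k) φ ≡ 0 → ∀ a → φ a ≡ 0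
      zero-at k φ e a = n≤0⇒n≡0 (≮⇒≥ λ pos → <-irrefl refl (<-≤-trans (*-pos (0<ω k) pos)
        (subst (ω k * φ a ≤_) e (∑-∈ (λ a → ω k * φ a) (∈-allFin a)))))
      miss≡0 : miss c (i , a) (j , b) ≡ 0
      miss≡0 = zero-at j (λ b → miss c (i , a) (j , b)) (zero-at i (λ a → part j (miss c (i , a))) pair-miss≡0 a) b

    index : Fin ℓ → Fin (r !)
    index i = proj₁ (surjective E (proj₁ (sorting r (p i))))

    sorted : ∀ i a b → toℕ a ≤ toℕ b → p i (π E (index i) ⟨$⟩ʳ b) ≤ p i (π E (index i) ⟨$⟩ʳ a)
    sorted i a b le = subst₂ _≤_ (cong (p i) (sym (eq b))) (cong (p i) (sym (eq a))) (proj₂ (sorting r (p i)) a b le)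
      where
      eq : PermEq (π E (index i)) (proj₁ (sorting r (p i)))
      eq = proj₂ (surjective E (proj₁ (sorting r (p i))))

    -- Two unbalanced parts with the same ordering would violate Chebyshev's inequality.
    index-injective : ∀ {i j} → ¬ Constant i → ¬ Constant j → index i ≡ index j → i ≡ j
    index-injective {i} {j} ¬ci ¬cj eq = from (i ≟ j)
      where
      σ = π E (index i)
      Sorted : Fin ℓ → Set
      Sorted k = ∀ a b → toℕ a ≤ toℕ b → p k (σ ⟨$⟩ʳ b) ≤ p k (σ ⟨$⟩ʳ a)
      sortedʲ : Sorted j
      sortedʲ = subst (λ e → ∀ a b → toℕ a ≤ toℕ b → p j (π E e ⟨$⟩ʳ b) ≤ p j (π E e ⟨$⟩ʳ a)) (sym eq) (sorted j)
      -- The heaviest and the lightest class. In an unbalanced part they differ strictly, and here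
      -- in the same direction for both parts.
      first last : Fin r
      first = σ ⟨$⟩ʳ zero
      last  = σ ⟨$⟩ʳ fromℕ r₀
      spread : ∀ k → Sorted k → ¬ Constant k → p k last < p k first
      spread k srt ¬const = ≰⇒> λ le → ¬const (λ s t → ≤-antisym (all≤ le s t) (all≤ le t s))
        where
        all≤ : p k first ≤ p k last → ∀ s t → p k s ≤ p k t
        all≤ le s t = begin
          p k s                        ≡⟨ cong (p k) (sym (inverseʳ σ)) ⟩
          p k (σ ⟨$⟩ʳ (σ ⟨$⟩ˡ s))       ≤⟨ srt zero (σ ⟨$⟩ˡ s) z≤n ⟩
          p k first                    ≤⟨ le ⟩
          p k last                     ≤⟨ srt (σ ⟨$⟩ˡ t) (fromℕ r₀) (≤fromℕ (σ ⟨$⟩ˡ t)) ⟩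
          p k (σ ⟨$⟩ʳ (σ ⟨$⟩ˡ t))       ≡⟨ cong (p k) (inverseʳ σ) ⟩
          p k t                        ∎
          where open ≤-Reasoning
      order : SameOrder (p i) (p j)
      order s t = subst₂ (λ s t → (p i s ≤ p i t × p j s ≤ p j t) ⊎ (p i t ≤ p i s × p j t ≤ p j s))
        (inverseʳ σ) (inverseʳ σ) (compare (σ ⟨$⟩ˡ s) (σ ⟨$⟩ˡ t))
        where
        compare : ∀ x y → (p i (σ ⟨$⟩ʳ x) ≤ p i (σ ⟨$⟩ʳ y) × p j (σ ⟨$⟩ʳ x) ≤ p j (σ ⟨$⟩ʳ y)) ⊎
                          (p i (σ ⟨$⟩ʳ y) ≤ p i (σ ⟨$⟩ʳ x) × p j (σ ⟨$⟩ʳ y) ≤ p j (σ ⟨$⟩ʳ x))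
        compare x y with ≤-total (toℕ x) (toℕ y)
        ... | inj₁ le = inj₂ (sorted i x y le , sortedʲ x y le)
        ... | inj₂ ge = inj₁ (sorted i y x ge , sortedʲ y x ge)
      from : Dec (i ≡ j) → i ≡ j
      from (yes e) = e
      from (no ne) = contradiction
        (chebyshev-tight (p i) (p j) order (r*agreement≤ ne) (∈-allFin last) (∈-allFin first))
        (<⇒≱ (strict-rearrangement (spread i (sorted i) ¬ci) (spread j sortedʲ ¬cj)))

    slot : Fin ℓ → Fin ℓ
    slot i = inject≤ (index i) large

    unbalanced : List (Fin ℓ)
    unbalanced = filter (λ i → ¬? (constant? i)) (allFin ℓ)

    ∈-unbalanced : ∀ {i} → i ∈ unbalanced → ¬ Constant i
    ∈-unbalanced i∈ = proj₂ (∈-filter⁻ (λ i → ¬? (constant? i)) {xs = allFin ℓ} i∈)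

    -- An unbalanced part must go to the position of a permutation that sorts it, and these
    -- positions are distinct. The balanced parts fill the remaining ones arbitrarily, since
    -- constant class sizes satisfy `ordered` as well as `balanced`.
    placement : Σ (Permutation′ ℓ) λ τ → ∀ {i} → i ∈ unbalanced → τ ⟨$⟩ʳ i ≡ slot i
    placement = extend-injection unbalanced (Unique.filter⁺ (λ i → ¬? (constant? i)) (Unique.allFin⁺ ℓ)) slot
      (λ {x} {y} x∈ y∈ e → index-injective (∈-unbalanced x∈) (∈-unbalanced y∈) (inject≤-injective large large (index x) (index y) e))

    τ : Permutation′ ℓ
    τ = proj₁ placement

    place : Fin ℓ → Fin ℓ
    place i′ = τ ⟨$⟩ˡ i′

    slot-place : ∀ i′ → ¬ Constant (place i′) → slot (place i′) ≡ i′
    slot-place i′ ¬const = trans (sym (proj₂ placement (∈-filter⁺ (λ i → ¬? (constant? i)) (∈-allFin (place i′)) ¬const))) (inverseʳ τ)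

    index-place : ∀ i′ → ¬ Constant (place i′) → toℕ (index (place i′)) ≡ toℕ i′
    index-place i′ ¬const = trans (sym (toℕ-inject≤ (index (place i′)) large)) (cong toℕ (slot-place i′ ¬const))

    low : ∀ i′ → ¬ Constant (place i′) → Low (suc (suc r₀)) i′
    low i′ ¬const = subst (_< r !) (index-place i′ ¬const) (toℕ<n (index (place i′)))

    parameters : ClassParams (suc (suc r₀)) ℓ E
    parameters = record
      { n        = λ i′ → cnt (place i′)
      ; ordered  = λ i′ lo a b le → cnt-≤ (place i′) _ _ (order i′ lo a b le (constant? (place i′)))
      ; balanced = λ i′ ¬lo s t → bal i′ ¬lo s t (constant? (place i′))
      ; positive = λ i′ → positive-at (place i′)
      }
      where
      order : ∀ i′ (lo : Low (suc (suc r₀)) i′) a b → toℕ a ≤ toℕ b → Dec (Constant (place i′)) →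
              p (place i′) (π E (fromℕ< lo) ⟨$⟩ʳ b) ≤ p (place i′) (π E (fromℕ< lo) ⟨$⟩ʳ a)
      order i′ lo a b le (yes const) = ≤-reflexive (const _ _)
      order i′ lo a b le (no ¬const) = subst (λ e → p (place i′) (π E e ⟨$⟩ʳ b) ≤ p (place i′) (π E e ⟨$⟩ʳ a))
        (toℕ-injective (trans (index-place i′ ¬const) (sym (toℕ-fromℕ< lo)))) (sorted (place i′) a b le)
      bal : ∀ i′ → ¬ Low (suc (suc r₀)) i′ → ∀ s t → Dec (Constant (place i′)) → cnt (place i′) s ≡ cnt (place i′) t
      bal i′ ¬lo s t (yes const) = ≤-antisym (cnt-≤ _ s t (≤-reflexive (const s t))) (cnt-≤ _ t s (≤-reflexive (const t s)))
      bal i′ ¬lo s t (no ¬const) = contradiction (low i′ ¬const) ¬lo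
      positive-at : ∀ i → 0 < ∑ (allFin r) (cnt i)
      positive-at i = <-≤-trans (<-≤-trans (s≤s z≤n) (toℕ<n (proj₂ (Inverse.from (F.fibration i) (fromℕ< (nonempty G i))))))
        (∑-∈ (cnt i) (∈-allFin (proj₁ (Inverse.from (F.fibration i) (fromℕ< (nonempty G i))))))

    assignment : CVertex parameters ↔ Vertex G
    assignment = Σ-cong (↔-sym τ) (λ {i′} → F.fibration (place i′))

    to : CVertex parameters → Vertex G
    to = Inverse.to assignment

    colour-to : ∀ x → c (to x) ≡ proj₁ (proj₂ x)
    colour-to (i′ , s , t) = F.f-element (place i′) s t

    place-injective : ∀ {i j} → place i ≡ place j → i ≡ j
    place-injective e = trans (sym (inverseʳ τ)) (trans (cong (τ ⟨$⟩ʳ_) e) (inverseʳ τ))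

    -- Adjacency is pulled back from G, so the isomorphism is immediate and the conditions of the
    -- class become statements about G.
    graph : ClassGraph (suc (suc r₀)) ℓ E
    graph = record
      { params = parameters
      ; hadj   = λ x y → adj G (to x) (to y)
      ; hsymm  = λ x y → symm G (to x) (to y)
      ; sub    = λ x y xy →
          (λ e → true≢false (trans (sym xy) (partite G (to x) (to y) (cong place e)))) ,
          (λ e → proper (to x) (to y) xy (trans (colour-to x) (trans e (sym (colour-to y)))))
      ; kept   = keep
      }
      where
      true≢false : true ≢ false
      true≢false ()
      keep : ∀ x y → BarEdge parameters x y → ¬ Deletable parameters x y → adj G (to x) (to y) ≡ true
      keep x@(i′ , s , t) y@(j′ , s′ , t′) (i≢j , s≢s′) ¬del = complete (i≢j ∘ place-injective)
        (one-balanced (constant? (place i′)) (constant? (place j′))) _ _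
        (λ e → s≢s′ (trans (sym (colour-to x)) (trans e (colour-to y))))
        where
        one-balanced : Dec (Constant (place i′)) → Dec (Constant (place j′)) → Constant (place i′) ⊎ Constant (place j′)
        one-balanced (yes q) _        = inj₁ q
        one-balanced _       (yes q)  = inj₂ q
        -- Two unbalanced parts both sit at low positions, where edges between them may be deleted.
        one-balanced (no q)  (no q′)  = contradiction (i≢j , s≢s′ , low i′ q , low j′ q′) ¬del

  in-class : InClass (suc (suc r₀)) ℓ E G
  in-class = graph , ↔-sym assignment , λ u v →
    cong₂ (adj G) (sym (Inverse.strictlyInverseˡ assignment u)) (sym (Inverse.strictlyInverseˡ assignment v))

theorem2 : ∀ (k : ℕ) → 2 ≤ k → ∃[ ℓ₀ ] (∀ (ℓ : ℕ) → ℓ₀ ≤ ℓ →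
    ∀ (E : PermEnumeration (k ∸ 1)) (G : PartiteGraph ℓ) →
    DensityCondition k G → ContainsK k G ⊎ InClass k ℓ E G)
-- The first summand serves the colouring; the second provides the (k-1)! low positions among the ℓ
-- parts.
theorem2 (suc (suc r₀)) (s≤s (s≤s z≤n)) = colouring-threshold r₀ + (suc r₀) ! , main
  where
  main : ∀ (ℓ : ℕ) → colouring-threshold r₀ + (suc r₀) ! ≤ ℓ →
    ∀ (E : PermEnumeration (suc r₀)) (G : PartiteGraph ℓ) →
    DensityCondition (suc (suc r₀)) G → ContainsK (suc (suc r₀)) G ⊎ InClass (suc (suc r₀)) ℓ E G
  main ℓ large E G density with Parts.clique? G (λ _ → yes tt) (suc (suc r₀))
  ... | yes (Cliques.clique f _ adj-f) = inj₁ (f , injective-f , adj-f)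
    where
    injective-f : ∀ a b → f a ≡ f b → a ≡ b
    injective-f a b e with a ≟ b
    ... | yes p = p
    ... | no ne = contradiction (trans (sym (adj-f a b ne)) (partite G (f a) (f b) (cong proj₁ e))) λ ()
  ... | no noClique = inj₂ (ClassConstruction.in-class r₀ G density noClique E
        (≤-trans (m≤n+m ((suc r₀) !) (colouring-threshold r₀)) large) (proj₁ colouring) (proj₂ colouring))
    where
    colouring = proper-colouring r₀ (≤-trans (m≤m+n (colouring-threshold r₀) ((suc r₀) !)) large) G density noClique
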